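{- There is a linear time (i.e. $O(n+m)$ for a graph with $n$ vertices and $m$ edges given by adjacency lists) certifying recognition algorithm for trivially perfect graphs that uses a maxDFS once and only once.
   Context: Graphs are finite, simple and undirected. A graph is trivially perfect if it contains neither $C_4$ (cycle on 4 vertices) nor $P_4$ (path on 4 vertices) as an induced subgraph. Equivalently, it admits a vertex ordering having no triple $a<b<c$ with ($ab,bc\in E$, $ac\notin E$) and no triple $a<b<c$ with ($ac,bc\in E$, $ab\notin E$). A certifying recognition algorithm decides whether the input graph belongs to the class and outputs a certificate of its answer: for a positive answer, a vertex ordering avoiding the two patterns above (or a rooted forest whose transitive closure is the graph); for a negative answer, four vertices inducing a $C_4$ or a $P_4$. A maxDFS is a Depth First Search in which ties between eligible vertices are broken by largest degree (degrees in the input graph, a fixed priority): the search starts at a vertex of maximum degree, the recursive call is always made on an unvisited neighbour of largest degree of the current vertex, and, if the graph is disconnected, the search restarts at an unvisited vertex of largest degree once a component is exhausted. -}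

module Defs where

open import Data.Bool using (Bool; true; false; not; _∧_)
open import Data.Empty using (⊥)
open import Data.Fin as Fin using (Fin; toℕ; fromℕ<)
import Data.Fin.Properties as Fin
open import Data.List using (List; []; _∷_; map; foldr; filter; length; allFin; cartesianProduct; reverse; tabulate)
open import Data.List.Membership.Propositional using (_∈_; _∉_)
open import Data.List.Relation.Binary.Permutation.Propositional using (_↭_)
open import Data.List.Relation.Binary.Sublist.Propositional using (_⊆_)
open import Data.List.Relation.Unary.Unique.Propositional using (Unique)
open import Data.Nat using (ℕ; suc; pred; _+_; _≤_; _%_; _≡ᵇ_; _<ᵇ_; _<?_)
import Data.Nat.Properties as ℕ
open import Data.Product using (_×_; _,_; ∃; ∃-syntax)
open import Data.Sum using (_⊎_; swap)
open import Function using (_⇔_; Injective)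
open import Level using (0ℓ)
open import Relation.Binary using (Rel; Symmetric; Decidable)
open import Relation.Binary.PropositionalEquality using (_≡_)
open import Relation.Nullary using (¬_; yes; no)
open import Relation.Nullary.Decidable using (_×-dec_; _⊎-dec_; ¬?; from-yes)

------------------------------------------------------------------------
-- Graphs

record Graph (n : ℕ) : Set₁ where
  field
    _∼_    : Rel (Fin n) 0ℓ
    _∼?_   : Decidable _∼_
    symm   : Symmetric _∼_
    irrefl : ∀ v → ¬ (v ∼ v)

  degree : Fin n → ℕ
  degree v = length (filter (v ∼?_) (allFin n))

  -- Each edge {i , j} is counted once, as the pair with i < j.
  edgeCount : ℕ
  edgeCount = length (filter (λ (i , j) → (i Fin.<? j) ×-dec (i ∼? j))
                             (cartesianProduct (allFin n) (allFin n)))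

P₄ : Graph 4
P₄ = record
  { _∼_    = λ i j → suc (toℕ i) ≡ toℕ j ⊎ suc (toℕ j) ≡ toℕ i
  ; _∼?_   = λ i j → (suc (toℕ i) ℕ.≟ toℕ j) ⊎-dec (suc (toℕ j) ℕ.≟ toℕ i)
  ; symm   = swap
  ; irrefl = from-yes (Fin.all? {n = 4} λ i → ¬? ((suc (toℕ i) ℕ.≟ toℕ i) ⊎-dec (suc (toℕ i) ℕ.≟ toℕ i)))
  }

C₄ : Graph 4
C₄ = record
  { _∼_    = λ i j → suc (toℕ i) % 4 ≡ toℕ j ⊎ suc (toℕ j) % 4 ≡ toℕ i
  ; _∼?_   = λ i j → (suc (toℕ i) % 4 ℕ.≟ toℕ j) ⊎-dec (suc (toℕ j) % 4 ℕ.≟ toℕ i)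
  ; symm   = swap
  ; irrefl = from-yes (Fin.all? {n = 4} λ i → ¬? ((suc (toℕ i) % 4 ℕ.≟ toℕ i) ⊎-dec (suc (toℕ i) % 4 ℕ.≟ toℕ i)))
  }

record InducedCopy {k n} (H : Graph k) (G : Graph n) (f : Fin k → Fin n) : Set where
  private
    module H = Graph H
    module G = Graph G
  field
    injective : Injective _≡_ _≡_ f
    induced   : ∀ i j → (i H.∼ j) ⇔ (f i G.∼ f j)

TriviallyPerfect : ∀ {n} → Graph n → Set
TriviallyPerfect G = ¬ ∃ (InducedCopy C₄ G) × ¬ ∃ (InducedCopy P₄ G)

module _ {n} (G : Graph n) where
  open Graph G

  -- In a duplicate-free list, `a ∷ b ∷ c ∷ [] ⊆ order` says a < b < c.
  record AvoidingOrder (order : List (Fin n)) : Set where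
    field
      enumerates : order ↭ allFin n
      avoids₁    : ∀ {a b c} → a ∷ b ∷ c ∷ [] ⊆ order → ¬ (a ∼ b × b ∼ c × ¬ (a ∼ c))
      avoids₂    : ∀ {a b c} → a ∷ b ∷ c ∷ [] ⊆ order → ¬ (a ∼ c × b ∼ c × ¬ (a ∼ b))

  ----------------------------------------------------------------------
  -- maxDFS

  Largest : (Fin n → Set) → Fin n → Set
  Largest Eligible u = Eligible u × (∀ w → Eligible w → degree w ≤ degree u)

  -- S, S₁, S₂ list the vertices visited so far, latest first.
  -- `Explore S v S₂`: the call at v, continued when S has been visited
  -- (v included), returns when S₂ has been visited.
  data Explore (S : List (Fin n)) (v : Fin n) : List (Fin n) → Set where
    return  : (∀ w → v ∼ w → w ∈ S) → Explore S v S
    descend : ∀ {u S₁ S₂} → Largest (λ w → v ∼ w × w ∉ S) u →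
              Explore (u ∷ S) u S₁ → Explore S₁ v S₂ → Explore S v S₂

  data Search (S : List (Fin n)) : List (Fin n) → Set where
    finish : (∀ w → w ∈ S) → Search S S
    start  : ∀ {u S₁ S₂} → Largest (_∉ S) u →
             Explore (u ∷ S) u S₁ → Search S₁ S₂ → Search S S₂

  MaxDFSOrder : List (Fin n) → Set
  MaxDFSOrder order = Search [] (reverse order)

  record AdjacencyLists : Set where
    field
      neighbours : Fin n → List (Fin n)
      unique     : ∀ v → Unique (neighbours v)
      complete   : ∀ v w → (w ∈ neighbours v) ⇔ (v ∼ w)

------------------------------------------------------------------------
-- The machine: while-programs over finitely many registers and arrays.
-- A cell holds a natural number or a pointer to an immutable pair, so
-- copying a value takes constant time.  The only arithmetic is ±1: numbers
-- stay bounded by the input size plus a constant times the running time,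
-- and unit cost is not abused by packing data into large numbers.

data Value : Set where
  nil  : Value
  num  : ℕ → Value
  cons : Value → Value → Value

toNum : Value → ℕ
toNum (num k) = k
toNum _       = 0

first second : Value → Value
first (cons x _) = x
first _          = nil
second (cons _ y) = y
second _          = nil

isCons : Value → Bool
isCons (cons _ _) = true
isCons _          = false

Register Array : Set
Register = ℕ
Array    = ℕ

record State : Set where
  constructor state
  field
    reg : Register → Value
    arr : Array → ℕ → Value
open State public

update : {A : Set} → (ℕ → A) → ℕ → A → ℕ → A
update f i x j with j ℕ.≟ i
... | yes _ = x
... | no  _ = f j

setReg : Register → Value → State → State
setReg x v σ = record σ { reg = update (reg σ) x v }

setArr : Array → ℕ → Value → State → State
setArr a i v σ = record σ { arr = update (arr σ) a (update (arr σ a) i v) }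

data Expr : Set where
  var       : Register → Expr
  lit       : ℕ → Expr
  nil       : Expr
  succ prec : Expr → Expr
  pair      : Expr → Expr → Expr
  fst snd   : Expr → Expr
  _[_]      : Array → Expr → Expr

data Test : Set where
  _==_ _<<_ : Expr → Expr → Test
  pair?     : Expr → Test
  !_        : Test → Test
  _&&_      : Test → Test → Test

eval : State → Expr → Value
eval σ (var x)    = reg σ x
eval σ (lit k)    = num k
eval σ nil        = nil
eval σ (succ e)   = num (suc (toNum (eval σ e)))
eval σ (prec e)   = num (pred (toNum (eval σ e)))
eval σ (pair d e) = cons (eval σ d) (eval σ e)
eval σ (fst e)    = first (eval σ e)
eval σ (snd e)    = second (eval σ e)
eval σ (a [ e ])  = arr σ a (toNum (eval σ e))

test : State → Test → Bool
test σ (d == e)  = toNum (eval σ d) ≡ᵇ toNum (eval σ e)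
test σ (d << e)  = toNum (eval σ d) <ᵇ toNum (eval σ e)
test σ (pair? e) = isCons (eval σ e)
test σ (! b)     = not (test σ b)
test σ (b && c)  = test σ b ∧ test σ c

infixr 4 _⨾_
infix  5 _:=_ _[_]:=_

data Program : Set where
  skip          : Program
  _:=_          : Register → Expr → Program
  _[_]:=_       : Array → Expr → Expr → Program
  _⨾_           : Program → Program → Program
  if_then_else_ : Test → Program → Program → Program
  while_loop_   : Test → Program → Program
  _:=search     : Register → Program

-- `Exec Returns p σ t k σ′`: from σ, p halts in σ′ after t steps and k
-- executions of `:=search`, where `Returns s v` says that the search
-- procedure takes s steps and returns v; those s steps are part of t.
-- The expressions of a fixed program have bounded size, hence one step
-- for each assignment or test.
data Exec (Returns : ℕ → Value → Set) : Program → State → ℕ → ℕ → State → Set where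
  skip   : ∀ {σ} → Exec Returns skip σ 1 0 σ
  assign : ∀ {x e σ} → Exec Returns (x := e) σ 1 0 (setReg x (eval σ e) σ)
  store  : ∀ {a d e σ} →
           Exec Returns (a [ d ]:= e) σ 1 0 (setArr a (toNum (eval σ d)) (eval σ e) σ)
  seq    : ∀ {p q σ σ₁ σ₂ t₁ t₂ k₁ k₂} →
           Exec Returns p σ t₁ k₁ σ₁ → Exec Returns q σ₁ t₂ k₂ σ₂ →
           Exec Returns (p ⨾ q) σ (t₁ + t₂) (k₁ + k₂) σ₂
  ifTrue  : ∀ {b p q σ σ′ t k} → test σ b ≡ true → Exec Returns p σ t k σ′ →
           Exec Returns (if b then p else q) σ (suc t) k σ′
  ifFalse : ∀ {b p q σ σ′ t k} → test σ b ≡ false → Exec Returns q σ t k σ′ →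
           Exec Returns (if b then p else q) σ (suc t) k σ′
  exit   : ∀ {b p σ} → test σ b ≡ false →
           Exec Returns (while b loop p) σ 1 0 σ
  repeat : ∀ {b p σ σ₁ σ₂ t₁ t₂ k₁ k₂} → test σ b ≡ true →
           Exec Returns p σ t₁ k₁ σ₁ → Exec Returns (while b loop p) σ₁ t₂ k₂ σ₂ →
           Exec Returns (while b loop p) σ (suc (t₁ + t₂)) (k₁ + k₂) σ₂
  search : ∀ {x σ s v} → Returns s v →
           Exec Returns (x :=search) σ (suc s) 1 (setReg x v σ)

------------------------------------------------------------------------
-- Input and output conventions

encode : ∀ {n} → List (Fin n) → Value
encode = foldr (λ v → cons (num (toℕ v))) nil

-- Register 0 holds n, cell v of array 0 the adjacency list of vertex v;
-- all other memory is nil.  The result is left in register 1.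
module _ {n} {G : Graph n} (L : AdjacencyLists G) where
  open AdjacencyLists L

  row : ℕ → Value
  row i with i <? n
  ... | yes i<n = encode (neighbours (fromℕ< i<n))
  ... | no  _   = nil

  input : State
  input = state (λ { 0 → num n ; (suc _) → nil })
                (λ { 0 → row   ; (suc _) _ → nil })

  Yields : (ℕ → Value → Set) → Program → ℕ → ℕ → Value → Set
  Yields Returns p t k v = ∃[ σ ] (Exec Returns p input t k σ × reg σ 1 ≡ v)

  -- With no possible return value, `:=search` never completes: a search
  -- procedure cannot itself call a search.
  YieldsAlone : Program → ℕ → Value → Set
  YieldsAlone p t v = Yields (λ _ _ → ⊥) p t 0 v

  -- `:=search` runs the program d on the input graph, in memory of its own.
  YieldsCalling : Program → Program → ℕ → ℕ → Value → Set
  YieldsCalling d = Yields (YieldsAlone d)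

ImplementsMaxDFS : Program → Set₁
ImplementsMaxDFS d = ∀ {n} (G : Graph n) (L : AdjacencyLists G) →
  ∃[ t ] ∃[ order ] (YieldsAlone L d t (encode order) × MaxDFSOrder G order)

-- The answer is tagged 1 (yes) or 0 (no) and followed by its certificate.
module _ {n} (G : Graph n) where

  data CorrectAnswer : Value → Set where
    accept : ∀ {order} → TriviallyPerfect G → AvoidingOrder G order →
             CorrectAnswer (cons (num 1) (encode order))
    reject : ∀ {f : Fin 4 → Fin n} → ¬ TriviallyPerfect G →
             InducedCopy C₄ G f ⊎ InducedCopy P₄ G f →
             CorrectAnswer (cons (num 0) (encode (tabulate f)))

{-# OPTIONS --safe #-}
module Submission where

open import Defs
open import Data.Bool using (Bool; true; false; not; _∧_; T)
open import Data.Bool.Properties using (T-∧)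
open import Data.Empty using (⊥; ⊥-elim)
open import Data.Fin as Fin using (Fin; toℕ; zero; suc)
import Data.Fin.Properties as Fin
open import Data.List using (List; []; _∷_; _++_; _ʳ++_; map; filter; length; allFin; cartesianProduct; reverse)
import Data.List.Membership.DecPropositional as DecMembership
open import Data.List.Membership.Propositional using (_∈_; _∉_)
open import Data.List.Membership.Propositional.Properties
  using (∈-∃++; ∈-++⁺ˡ; ∈-++⁺ʳ; ∈-++⁻; ∈-filter⁺; ∈-filter⁻; ∈-allFin)
open import Data.List.Membership.Propositional.Properties.WithK using (unique∧set⇒bag)
import Data.List.Properties as List
open import Data.List.Relation.Binary.BagAndSetEquality using (∼bag⇒↭)
open import Data.List.Relation.Binary.Permutation.Propositional using (_↭_; ↭-sym; ↭-trans)
open import Data.List.Relation.Binary.Permutation.Propositional.Properties using (↭-length; map⁺; ∈-resp-↭; ↭-reverse)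
open import Data.List.Relation.Binary.Sublist.Propositional as Sublist using (_⊆_; _∷ʳ_; _∷_; [])
import Data.List.Relation.Binary.Sublist.Setoid.Properties as Sublist
open import Data.List.Relation.Unary.All as All using (All; []; _∷_)
open import Data.List.Relation.Unary.AllPairs as AllPairs using (AllPairs; []; _∷_)
import Data.List.Relation.Unary.AllPairs.Properties as AllPairs
open import Data.List.Relation.Unary.Any using (here; there)
open import Data.List.Relation.Unary.Unique.Propositional using (Unique)
import Data.List.Relation.Unary.Unique.Propositional.Properties as Unique
open import Data.Nat using (ℕ; suc; pred; _+_; _*_; _≤_; _<_; _≡ᵇ_; _<ᵇ_; _<?_; z≤n; s≤s)
open import Data.Nat.ListAction using (sum)
open import Data.Nat.ListAction.Properties using (sum-↭)
import Data.Nat.Properties as ℕ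
open import Data.Nat.Tactic.RingSolver using (solve-∀)
open import Data.Product using (_×_; _,_; proj₁; proj₂; ∃; ∃-syntax)
open import Data.Sum as Sum using (_⊎_; inj₁; inj₂)
open import Data.Unit using (⊤; tt)
open import Function using (_⇔_; mk⇔; Equivalence; id; _∘_)
open import Relation.Binary using (tri<; tri≈; tri>)
open import Relation.Binary.PropositionalEquality
  using (_≡_; _≢_; refl; sym; trans; cong; cong₂; subst; subst₂; setoid; module ≡-Reasoning)
open import Relation.Nullary using (¬_; Dec; yes; no; does; contradiction)
open import Relation.Nullary.Decidable using (_×-dec_)

-- In a maxDFS order, let a be visited before b and adjacent to b.  If b has the
-- larger degree, then a was not the first vertex, and the vertex p from which a was
-- reached is not adjacent to b, as it would have preferred b.  In either case
-- N[b] ⊄ N[a] implies N[a] ⊄ N[b], and such an edge ab is the middle of an induced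
-- P₄ or C₄: take a private neighbour of each end.
--
-- Let E(v) be the list of the neighbours of v visited before v, latest first.  If
-- E(v) is empty or p ∷ E(p) for every v, then G is the transitive closure of a rooted
-- forest whose vertices are listed parents first.  Otherwise compare E(v) = p ∷ r with s = E(p) at
-- their first difference: a later vertex in r is not adjacent to p, and a later
-- vertex z in s is not adjacent to v, so pv, respectively zp, is an edge with
-- N[v] ⊄ N[p], respectively N[p] ⊄ N[z].  The comparison takes time |E(v)|.
--
-- The maxDFS itself is linear because bucket sort puts all adjacency lists in order
-- of decreasing degree, after which every list is read once.

-- A mismatch exhibits the private neighbour of only one end of the reported edge, the one visited
-- later. The other is owed to the search, by an argument that is partly a count and then names no
-- vertex. Crossing edges therefore carry doubly negated existence statements, and the program looks
-- for both witnesses only once, after the scan, by marking neighbourhoods. The search reports no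
-- parents. The vertex p is read off as the latest visited neighbour of v; the rest of E(v) then
-- consists of vertices visited before p, as does E(p). Both are subsequences of one list, so
-- visiting times alone decide which of the two misses the vertex at the first difference, and no
-- adjacency test is needed.

update-same : ∀ {A : Set} (f : ℕ → A) i x → update f i x i ≡ x
update-same f i x with i ℕ.≟ i
... | yes _  = refl
... | no i≢i = ⊥-elim (i≢i refl)

update-other : ∀ {A : Set} (f : ℕ → A) {i j} x → j ≢ i → update f i x j ≡ f j
update-other f {i} {j} x j≢i with j ℕ.≟ i
... | yes j≡i = ⊥-elim (j≢i j≡i)
... | no _    = refl

-- Frame conditions: the registers and arrays that a program keeps

keepsReg : Program → Register → Bool
keepsReg skip                   x = true
keepsReg (y := _)               x = not (x ≡ᵇ y)
keepsReg (_ [ _ ]:= _)          x = true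
keepsReg (p ⨾ q)                x = keepsReg p x ∧ keepsReg q x
keepsReg (if _ then p else q)   x = keepsReg p x ∧ keepsReg q x
keepsReg (while _ loop p)       x = keepsReg p x
keepsReg (y :=search)           x = not (x ≡ᵇ y)

keepsArr : Program → Array → Bool
keepsArr skip                   a = true
keepsArr (_ := _)               a = true
keepsArr (b [ _ ]:= _)          a = not (a ≡ᵇ b)
keepsArr (p ⨾ q)                a = keepsArr p a ∧ keepsArr q a
keepsArr (if _ then p else q)   a = keepsArr p a ∧ keepsArr q a
keepsArr (while _ loop p)       a = keepsArr p a
keepsArr (_ :=search)           a = true

≢ᵇ⇒≢ : ∀ m n → T (not (m ≡ᵇ n)) → m ≢ n
≢ᵇ⇒≢ m n h m≡n with m ≡ᵇ n | ℕ.≡⇒≡ᵇ m n m≡n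
... | true | _ = h

-- For a concrete program and register the argument `T (keepsReg p x)` computes to `⊤` and is
-- inferred, so that a frame fact is just `regs u x`. Arrays are kept as a whole or not at all.
record Unchanged (p : Program) (σ σ′ : State) : Set where
  field
    regs : ∀ x {_ : T (keepsReg p x)} → reg σ′ x ≡ reg σ x
    arrs : ∀ a {_ : T (keepsArr p a)} i → arr σ′ a i ≡ arr σ a i
open Unchanged public

unchanged-refl : ∀ {p σ} → Unchanged p σ σ
unchanged-refl = record { regs = λ _ → refl ; arrs = λ _ _ → refl }

unchanged-trans : ∀ {p σ₁ σ₂ σ₃} → Unchanged p σ₁ σ₂ → Unchanged p σ₂ σ₃ → Unchanged p σ₁ σ₃
unchanged-trans u₁ u₂ = record
  { regs = λ x {h} → trans (regs u₂ x {h}) (regs u₁ x {h})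
  ; arrs = λ a {h} i → trans (arrs u₂ a {h} i) (arrs u₁ a {h} i) }

module _ {Returns : ℕ → Value → Set} where

  keepReg : ∀ {p σ t k σ′} → Exec Returns p σ t k σ′ → ∀ x {_ : T (keepsReg p x)} →
            reg σ′ x ≡ reg σ x
  keepReg skip x = refl
  keepReg {σ = σ} (assign {y}) x {h} = update-other (reg σ) _ (≢ᵇ⇒≢ x y h)
  keepReg store x = refl
  keepReg (seq e₁ e₂) x {h} with h₁ , h₂ ← Equivalence.to T-∧ h =
    trans (keepReg e₂ x {h₂}) (keepReg e₁ x {h₁})
  keepReg (ifTrue _ e) x {h} with h₁ , _ ← Equivalence.to T-∧ h = keepReg e x {h₁}
  keepReg (ifFalse {p = p} _ e) x {h} with _ , h₂ ← Equivalence.to (T-∧ {keepsReg p x}) h = keepReg e x {h₂}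
  keepReg (exit _) x = refl
  keepReg (repeat _ e₁ e₂) x {h} = trans (keepReg e₂ x {h}) (keepReg e₁ x {h})
  keepReg {σ = σ} (search {y} _) x {h} = update-other (reg σ) _ (≢ᵇ⇒≢ x y h)

  keepArr : ∀ {p σ t k σ′} → Exec Returns p σ t k σ′ → ∀ a {_ : T (keepsArr p a)} i →
            arr σ′ a i ≡ arr σ a i
  keepArr skip a i = refl
  keepArr assign a i = refl
  keepArr {σ = σ} (store {b}) a {h} i = cong (λ f → f i) (update-other (arr σ) _ (≢ᵇ⇒≢ a b h))
  keepArr (seq e₁ e₂) a {h} i with h₁ , h₂ ← Equivalence.to T-∧ h =
    trans (keepArr e₂ a {h₂} i) (keepArr e₁ a {h₁} i)
  keepArr (ifTrue _ e) a {h} i with h₁ , _ ← Equivalence.to T-∧ h = keepArr e a {h₁} i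
  keepArr (ifFalse {p = p} _ e) a {h} i with _ , h₂ ← Equivalence.to (T-∧ {keepsArr p a}) h = keepArr e a {h₂} i
  keepArr (exit _) a i = refl
  keepArr (repeat _ e₁ e₂) a {h} i = trans (keepArr e₂ a {h} i) (keepArr e₁ a {h} i)
  keepArr (search _) a i = refl

  unchanged : ∀ {p σ t k σ′} → Exec Returns p σ t k σ′ → Unchanged p σ σ′
  unchanged ex = record { regs = keepReg ex ; arrs = keepArr ex }

-- Rules for total correctness with running time

reverse-ʳ++ : ∀ {A : Set} (xs : List A) → reverse (xs ʳ++ []) ≡ xs
reverse-ʳ++ xs = List.reverse-selfInverse {x = xs} refl

-- The 0 says that no search is called; the single `:=search` is treated by hand at the end. The
-- postcondition receives the time, so that exact counts and bounds can both be passed on.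
record Run (Returns : ℕ → Value → Set) (p : Program) (σ : State) (Q : ℕ → State → Set) : Set where
  constructor run
  field
    {time}  : ℕ
    {final} : State
    exec    : Exec Returns p σ time 0 final
    post    : Q time final

forEach : Register → Register → Program → Program
forEach r x p = while pair? (var r) loop (x := fst (var r) ⨾ r := snd (var r) ⨾ p)

module _ {Returns : ℕ → Value → Set} where

  private variable
    p q : Program
    b   : Test
    e d : Expr
    x a : ℕ
    σ   : State
    P Q : ℕ → State → Set

  weaken : Run Returns p σ P → (∀ {t σ′} → Unchanged p σ σ′ → P t σ′ → Q t σ′) →
           Run Returns p σ Q
  weaken (run ex h) f = run ex (f (unchanged ex) h)

  infixr 1 _andThen_
  _andThen_ : Run Returns p σ P →
              (∀ {t σ′} → Unchanged p σ σ′ → P t σ′ → Run Returns q σ′ (λ t′ → Q (t + t′))) →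
              Run Returns (p ⨾ q) σ Q
  run ex₁ h₁ andThen f with run ex₂ h₂ ← f (unchanged ex₁) h₁ = run (seq ex₁ ex₂) h₂

  run-skip : Q 1 σ → Run Returns skip σ Q
  run-skip = run skip

  -- The value enters as `v` with an equation, so that later states contain encoded lists instead of
  -- unevaluated expressions.
  run-assign : ∀ {v} → eval σ e ≡ v → Q 1 (setReg x v σ) → Run Returns (x := e) σ Q
  run-assign refl = run assign

  assign⨾ : ∀ {v} → eval σ e ≡ v → Run Returns q (setReg x v σ) (λ t → Q (suc t)) →
            Run Returns (x := e ⨾ q) σ Q
  assign⨾ refl (run ex h) = run (seq assign ex) h

  run-store : ∀ {i v} → toNum (eval σ d) ≡ i → eval σ e ≡ v → Q 1 (setArr a i v σ) →
              Run Returns (a [ d ]:= e) σ Q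
  run-store refl refl = run store

  store⨾ : ∀ {i v} → toNum (eval σ d) ≡ i → eval σ e ≡ v →
           Run Returns q (setArr a i v σ) (λ t → Q (suc t)) → Run Returns (a [ d ]:= e ⨾ q) σ Q
  store⨾ refl refl (run ex h) = run (seq store ex) h

  run-true : test σ b ≡ true → Run Returns p σ (λ t → Q (suc t)) →
             Run Returns (if b then p else q) σ Q
  run-true b≡ (run ex h) = run (ifTrue b≡ ex) h

  run-false : test σ b ≡ false → Run Returns q σ (λ t → Q (suc t)) →
              Run Returns (if b then p else q) σ Q
  run-false b≡ (run ex h) = run (ifFalse b≡ ex) h

  run-exit : test σ b ≡ false → Q 1 σ → Run Returns (while b loop p) σ Q
  run-exit b≡ = run (exit b≡)

  run-repeat : test σ b ≡ true → Run Returns p σ P →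
               (∀ {t σ′} → Unchanged p σ σ′ → P t σ′ →
                Run Returns (while b loop p) σ′ (λ t′ → Q (suc (t + t′)))) →
               Run Returns (while b loop p) σ Q
  run-repeat b≡ (run ex₁ h₁) f with run ex₂ h₂ ← f (unchanged ex₁) h₁ = run (repeat b≡ ex₁ ex₂) h₂

  private
    retime : ∀ (I : ℕ → State → Set) {τ τ′} → τ ≡ τ′ → I τ σ → I τ′ σ
    retime I refl h = h

    shift : ∀ τ t → τ + 1 + (3 + t) ≡ τ + suc (suc (suc t)) + 1
    shift = solve-∀

  -- In I done τ σ′, the list `done` is latest first and τ counts the steps
  -- made so far and the final exit of the loop.
  Iteration : ∀ {n} → Register → Register → Program → List (Fin n) →
              (List (Fin n) → ℕ → State → Set) → State → Set
  Iteration r x p vs I σ = ∀ done τ σ′ v rest →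
    done ʳ++ v ∷ rest ≡ vs → Unchanged (forEach r x p) σ σ′ → I done τ σ′ →
    Run Returns p (setReg r (encode rest) (setReg x (num (toℕ v)) σ′)) (λ t → I (v ∷ done) (τ + (3 + t)))

  -- An iteration costs the test and two assignments besides the body, hence `3 + t`. Since `go`
  -- charges the final exit in advance, as `τ + 1`, the invariant for the full list is already the
  -- postcondition.
  run-forEach : ∀ {n r x p} {_ : T (not (r ≡ᵇ x))} {_ : T (keepsReg p r)}
    (I : List (Fin n) → ℕ → State → Set) (vs : List (Fin n)) →
    Iteration r x p vs I σ →
    reg σ r ≡ encode vs → I [] 1 σ →
    Run Returns (forEach r x p) σ (I (reverse vs))
  run-forEach {σ = σ₀} {n = n} {r} {x} {p} {r≢x} {keep} I vs step = λ r≡ base → go [] vs 0 refl unchanged-refl r≡ base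
    where
    go : ∀ {σ} done rest τ → done ʳ++ rest ≡ vs → Unchanged (forEach r x p) σ₀ σ →
         reg σ r ≡ encode rest → I done (τ + 1) σ →
         Run Returns (forEach r x p) σ (λ t → I (reverse vs) (τ + t))
    go {σ} done [] τ refl same r≡ h rewrite reverse-ʳ++ done =
      run-exit (cong isCons r≡) h
    go {σ} done (v ∷ rest) τ whole same r≡ h =
      run-repeat {P = λ t σ′ → I (v ∷ done) (τ + suc t + 1) σ′ × reg σ′ r ≡ encode rest}
        (cong isCons r≡)
        (assign⨾ (cong first r≡)
          (assign⨾ (trans (cong second (update-other (reg σ) _ (≢ᵇ⇒≢ r x r≢x))) (cong second r≡))
            (weaken (step done (τ + 1) σ v rest whole same h) λ {t} u h′ →
              retime (I (v ∷ done)) (shift τ t) h′ ,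
              trans (regs u r {keep}) (update-same _ r _))))
        λ {t} u (h′ , r≡′) →
          weaken (go (v ∷ done) rest (τ + suc t) whole
                   (unchanged-trans same (record { regs = regs u ; arrs = arrs u })) r≡′ h′) λ {t′} _ →
            retime (I (reverse vs)) (ℕ.+-assoc τ (suc t) t′)

-- Duplicate-free lists and filters of sorted lists

module _ {A : Set} where

  ∉-head : ∀ {x : A} {xs} → All (x ≢_) xs → x ∉ xs
  ∉-head x∉ x∈ = All.lookup x∉ x∈ refl

  unique-↭ : ∀ {xs ys : List A} → Unique xs → Unique ys →
             (∀ {v} → v ∈ xs → v ∈ ys) → (∀ {v} → v ∈ ys → v ∈ xs) → xs ↭ ys
  unique-↭ xs! ys! to from = ∼bag⇒↭ (unique∧set⇒bag xs! ys! (mk⇔ to from))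

  unique-length : ∀ {xs ys : List A} → Unique xs → (∀ {v} → v ∈ xs → v ∈ ys) → length xs ≤ length ys
  unique-length [] sub = z≤n
  unique-length {x ∷ xs} (x∉ ∷ xs!) sub with as , bs , refl ← ∈-∃++ (sub (here refl)) =
    ℕ.≤-trans (s≤s (unique-length xs! sub′)) (ℕ.≤-reflexive (sym (trans (List.length-++ as)
      (trans (ℕ.+-suc (length as) (length bs)) (cong suc (sym (List.length-++ as)))))))
    where
    sub′ : ∀ {v} → v ∈ xs → v ∈ as ++ bs
    sub′ v∈ with ∈-++⁻ as (sub (there v∈))
    ... | inj₁ p           = ∈-++⁺ˡ p
    ... | inj₂ (here refl) = ⊥-elim (∉-head x∉ v∈)
    ... | inj₂ (there p)   = ∈-++⁺ʳ as p

  ∈-reverse : ∀ {v : A} {xs} → v ∈ reverse xs → v ∈ xs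
  ∈-reverse {xs = xs} = ∈-resp-↭ (↭-reverse xs)

  allPairs-++⁻ʳ : ∀ {R : A → A → Set} xs {ys} → AllPairs R (xs ++ ys) → AllPairs R ys
  allPairs-++⁻ʳ []       rs       = rs
  allPairs-++⁻ʳ (x ∷ xs) (_ ∷ rs) = allPairs-++⁻ʳ xs rs

  -- At the first mismatch of two filters of one decreasing list, the larger head
  -- is missing from the other filter.
  ∉-filter-head : ∀ {P Q : A → Set} (P? : ∀ v → Dec (P v)) (Q? : ∀ v → Dec (Q v)) (rank : A → ℕ)
    {B} com {x r s} → AllPairs (λ u v → rank v < rank u) B →
    filter P? B ≡ com ++ x ∷ r → filter Q? B ≡ com ++ s →
    (∀ {z s′} → s ≡ z ∷ s′ → rank z < rank x) → ¬ Q x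
  ∉-filter-head {P} {Q} P? Q? rank {B} com {x} {r} {s} sorted P≡ Q≡ s< Qx =
    absurd (∈-++⁻ com (subst (x ∈_) Q≡ (∈-filter⁺ Q? x∈B Qx)))
    where
    x∈B : x ∈ B
    x∈B = proj₁ (∈-filter⁻ P? (subst (x ∈_) (sym P≡) (∈-++⁺ʳ com (here refl))))
    before-x : ∀ ys {zs} → AllPairs (λ u v → rank v < rank u) (ys ++ x ∷ zs) → x ∈ ys → ⊥
    before-x (y ∷ ys) (y> ∷ _) (here refl) = ℕ.<-irrefl refl (All.lookup y> (∈-++⁺ʳ ys (here refl)))
    before-x (y ∷ ys) (_ ∷ rs) (there x∈)  = before-x ys rs x∈
    in-s : ∀ s → (∀ {z s′} → s ≡ z ∷ s′ → rank z < rank x) → AllPairs (λ u v → rank v < rank u) s → x ∈ s → ⊥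
    in-s (z ∷ s′) s< _ (here refl) = ℕ.<-irrefl refl (s< refl)
    in-s (z ∷ s′) s< (z> ∷ _) (there x∈) = ℕ.<-asym (s< refl) (All.lookup z> x∈)
    -- If `Q x` held, x would occur in `com ++ s`: not in `com`, whose members rank strictly above x
    -- in the first filter, and not in s, whose head is its largest member and ranks below x.
    absurd : x ∈ com ⊎ x ∈ s → ⊥
    absurd (inj₁ x∈) = before-x com (subst (AllPairs _) P≡ (AllPairs.filter⁺ P? sorted)) x∈
    absurd (inj₂ x∈) = in-s s s< (allPairs-++⁻ʳ com (subst (AllPairs _) Q≡ (AllPairs.filter⁺ Q? sorted))) x∈

-- Counting vertices and edges

count : ∀ {P : Set} → Dec P → ℕ
count (yes _) = 1
count (no _)  = 0

module _ {A : Set} where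

  sum-map-+ : ∀ (f g : A → ℕ) xs → sum (map (λ x → f x + g x) xs) ≡ sum (map f xs) + sum (map g xs)
  sum-map-+ f g [] = refl
  sum-map-+ f g (x ∷ xs) rewrite sum-map-+ f g xs = interchange (f x) (g x) _ _
    where
    interchange : ∀ a b c d → a + b + (c + d) ≡ a + c + (b + d)
    interchange = solve-∀

  sum-map-≤ : ∀ {f g : A → ℕ} → (∀ x → f x ≤ g x) → ∀ xs → sum (map f xs) ≤ sum (map g xs)
  sum-map-≤ f≤g []       = z≤n
  sum-map-≤ f≤g (x ∷ xs) = ℕ.+-mono-≤ (f≤g x) (sum-map-≤ f≤g xs)

  sum-swap : ∀ (f : A → A → ℕ) xs ys →
             sum (map (λ x → sum (map (f x) ys)) xs) ≡ sum (map (λ y → sum (map (λ x → f x y) xs)) ys)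
  sum-swap f [] ys = zeros ys
    where
    zeros : ∀ ys → 0 ≡ sum (map (λ (y : A) → 0) ys)
    zeros []       = refl
    zeros (_ ∷ ys) = zeros ys
  sum-swap f (x ∷ xs) ys =
    trans (cong (sum (map (f x) ys) +_) (sum-swap f xs ys)) (sym (sum-map-+ (f x) _ ys))

  length-filter-product : ∀ {P : A × A → Set} (P? : ∀ e → Dec (P e)) xs ys →
    length (filter P? (cartesianProduct xs ys)) ≡ sum (map (λ x → length (filter (λ y → P? (x , y)) ys)) xs)
  length-filter-product P? [] ys = refl
  length-filter-product P? (x ∷ xs) ys = begin
    length (filter P? (map (x ,_) ys ++ cartesianProduct xs ys))
      ≡⟨ cong length (List.filter-++ P? (map (x ,_) ys) _) ⟩
    length (filter P? (map (x ,_) ys) ++ filter P? (cartesianProduct xs ys))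
      ≡⟨ List.length-++ (filter P? (map (x ,_) ys)) ⟩
    length (filter P? (map (x ,_) ys)) + length (filter P? (cartesianProduct xs ys))
      ≡⟨ cong₂ _+_ (fibre ys) (length-filter-product P? xs ys) ⟩
    length (filter (λ y → P? (x , y)) ys) + _ ∎
    where
    open ≡-Reasoning
    fibre : ∀ ys → length (filter P? (map (x ,_) ys)) ≡ length (filter (λ y → P? (x , y)) ys)
    fibre [] = refl
    fibre (y ∷ ys) with does (P? (x , y))
    ... | true  = cong suc (fibre ys)
    ... | false = fibre ys

  length-filter-count : ∀ {P : A → Set} (P? : ∀ v → Dec (P v)) xs →
                        length (filter P? xs) ≡ sum (map (λ v → count (P? v)) xs)
  length-filter-count P? [] = refl
  length-filter-count P? (x ∷ xs) with P? x
  ... | yes _ = cong suc (length-filter-count P? xs)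
  ... | no _  = length-filter-count P? xs

module _ {n} (G : Graph n) where
  open Graph G

  -- The potential to which the running times are charged: handling a vertex and its adjacency list
  -- costs a constant times `suc (degree v)`.
  weight : List (Fin n) → ℕ
  weight D = sum (map (λ v → suc (degree v)) D)

  weight-↭ : ∀ {D D′} → D ↭ D′ → weight D ≡ weight D′
  weight-↭ D↭ = sum-↭ (map⁺ _ D↭)

  private
    arc : Fin n → Fin n → ℕ
    arc i j = count ((i Fin.<? j) ×-dec (i ∼? j))

    -- `arc` orients every edge from its smaller to its larger end, as `edgeCount` does, so a
    -- neighbour j of i is counted by one of `arc i j` and `arc j i`.
    degree≤arcs : ∀ i → degree i ≤ sum (map (λ j → arc i j + arc j i) (allFin n))
    degree≤arcs i rewrite length-filter-count (i ∼?_) (allFin n) = sum-map-≤ bound (allFin n)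
      where
      bound : ∀ j → count (i ∼? j) ≤ arc i j + arc j i
      bound j with i ∼? j | j ∼? i | i Fin.<? j | j Fin.<? i
      ... | no _    | _       | _       | _       = z≤n
      ... | yes _   | _       | yes _   | _       = s≤s z≤n
      ... | yes _   | yes _   | no _    | yes _   = s≤s z≤n
      ... | yes i∼j | no ¬j∼i | _       | _       = ⊥-elim (¬j∼i (symm i∼j))
      ... | yes i∼j | yes _   | no i≮j  | no j≮i  =
        ⊥-elim (irrefl i (subst (i ∼_) (Fin.toℕ-injective (ℕ.≤-antisym (ℕ.≮⇒≥ i≮j) (ℕ.≮⇒≥ j≮i))) i∼j))

  handshake : sum (map degree (allFin n)) ≤ edgeCount + edgeCount
  handshake = begin
    sum (map degree (allFin n))                              ≤⟨ sum-map-≤ degree≤arcs (allFin n) ⟩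
    sum (map (λ i → sum (map (λ j → arc i j + arc j i) (allFin n))) (allFin n))
      ≡⟨ cong sum (List.map-cong (λ i → sum-map-+ (arc i) (λ j → arc j i) (allFin n)) (allFin n)) ⟩
    sum (map (λ i → out i + into i) (allFin n))              ≡⟨ sum-map-+ out into (allFin n) ⟩
    sum (map out (allFin n)) + sum (map into (allFin n))
      ≡⟨ cong (sum (map out (allFin n)) +_) (sym (sum-swap arc (allFin n) (allFin n))) ⟩
    sum (map out (allFin n)) + sum (map out (allFin n))      ≡⟨ cong₂ _+_ arcs arcs ⟩
    edgeCount + edgeCount ∎
    where
    open ℕ.≤-Reasoning
    out into : Fin n → ℕ
    out i  = sum (map (arc i) (allFin n))
    into i = sum (map (λ j → arc j i) (allFin n))
    arcs : sum (map out (allFin n)) ≡ edgeCount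
    arcs = sym (trans (length-filter-product _ (allFin n) (allFin n))
      (cong sum (List.map-cong (λ i → length-filter-count (λ j → (i Fin.<? j) ×-dec (i ∼? j)) (allFin n)) (allFin n))))

  weight-allFin : weight (allFin n) ≤ 2 * (n + edgeCount)
  weight-allFin = begin
    weight (allFin n)                                  ≡⟨ split (allFin n) ⟩
    length (allFin n) + sum (map degree (allFin n))
      ≤⟨ ℕ.+-mono-≤ (ℕ.≤-reflexive (List.length-tabulate {n = n} id)) handshake ⟩
    n + (edgeCount + edgeCount)                        ≤⟨ ℕ.m≤m+n _ n ⟩
    n + (edgeCount + edgeCount) + n                    ≡⟨ double n edgeCount ⟩
    2 * (n + edgeCount) ∎
    where
    open ℕ.≤-Reasoning
    double : ∀ n m → n + (m + m) + n ≡ 2 * (n + m)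
    double = solve-∀
    split : ∀ D → weight D ≡ length D + sum (map degree D)
    split [] = refl
    split (v ∷ D) rewrite split D = cong suc (assoc (degree v) (length D) _)
      where
      assoc : ∀ a b c → a + (b + c) ≡ b + (a + c)
      assoc = solve-∀

-- Orders that come from rooted forests

module _ {n : ℕ} where

  -- Lists of visited vertices are latest first, so this lists what was visited before v.
  before : List (Fin n) → Fin n → List (Fin n)
  before []      v = []
  before (x ∷ D) v with v Fin.≟ x
  ... | yes _ = D
  ... | no _  = before D v

  before-here : ∀ v D → before (v ∷ D) v ≡ D
  before-here v D with v Fin.≟ v
  ... | yes _  = refl
  ... | no v≢v = ⊥-elim (v≢v refl)

  before-there : ∀ {v x} D → v ≢ x → before (x ∷ D) v ≡ before D v
  before-there {v} {x} D v≢x with v Fin.≟ x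
  ... | yes v≡x = ⊥-elim (v≢x v≡x)
  ... | no _    = refl

  before⊆ : ∀ D {v a} → a ∈ before D v → a ∈ D
  before⊆ (x ∷ D) {v} a∈ with v Fin.≟ x
  ... | yes _ = there a∈
  ... | no _  = there (before⊆ D a∈)

  allPairs-before : ∀ {R : Fin n → Fin n → Set} {D} v → AllPairs R D → AllPairs R (before D v)
  allPairs-before v [] = []
  allPairs-before {D = x ∷ D} v (_ ∷ rs) with v Fin.≟ x
  ... | yes _ = rs
  ... | no _  = allPairs-before v rs

  ∉-before : ∀ {D v} → Unique D → v ∉ before D v
  ∉-before {x ∷ D} {v} (x∉ ∷ D!) v∈ with v Fin.≟ x
  ... | yes refl = ∉-head x∉ v∈
  ... | no _     = ∉-before D! v∈

  position : List (Fin n) → Fin n → ℕ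
  position D v = length (before D v)

  position<length : ∀ D v → v ∈ D → position D v < length D
  position<length (x ∷ D) v v∈ with v Fin.≟ x
  ... | yes _ = ℕ.n<1+n _
  position<length (x ∷ D) v (here v≡x) | no v≢x = ⊥-elim (v≢x v≡x)
  position<length (x ∷ D) v (there v∈) | no _ = ℕ.m<n⇒m<1+n (position<length D v v∈)

  ∈-≢ : ∀ {x v : Fin n} {D} → All (x ≢_) D → v ∈ D → v ≢ x
  ∈-≢ x∉ v∈ refl = ∉-head x∉ v∈

  position-decreasing : ∀ {D} → Unique D → AllPairs (λ u v → position D v < position D u) D
  position-decreasing [] = []
  position-decreasing {x ∷ D} (x∉ ∷ D!) =
    All.tabulate (λ {v} v∈ → subst₂ _<_ (sym (cong length (before-there D (∈-≢ x∉ v∈))))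
                                        (sym (cong length (before-here x D))) (position<length D v v∈)) ∷
    lift D x∉ (position-decreasing D!)
    where
    lift : ∀ E → All (x ≢_) E → AllPairs (λ u v → position D v < position D u) E →
           AllPairs (λ u v → position (x ∷ D) v < position (x ∷ D) u) E
    lift [] _ [] = []
    lift (y ∷ E) (x≢y ∷ x∉E) (r ∷ rs) =
      All.tabulate (λ v∈ → subst₂ _<_ (sym (cong length (before-there D (∈-≢ x∉E v∈))))
                                      (sym (cong length (before-there D (x≢y ∘ sym)))) (All.lookup r v∈)) ∷
      lift E x∉E rs

  -- Whatever follows the head p of a filtered list lies behind p in D, that is, was visited before
  -- p. This makes the tail of E(v) a filter of `before D p`, just as E(p) is.
  filter-tail : ∀ {P : Fin n → Set} (P? : ∀ v → Dec (P v)) {D p r} → Unique D →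
                filter P? D ≡ p ∷ r → r ≡ filter P? (before D p)
  filter-tail P? {x ∷ D} (x∉ ∷ D!) eq with P? x
  filter-tail P? {x ∷ D} (x∉ ∷ D!) refl | yes _ = sym (cong (filter P?) (before-here x D))
  ... | no _ = trans (filter-tail P? D! eq)
    (sym (cong (filter P?) (before-there D (∈-≢ x∉ (proj₁ (∈-filter⁻ P? (subst (_ ∈_) (sym eq) (here refl))))))))

  precedes : ∀ {D x y} → Unique D → x ∷ y ∷ [] ⊆ D → y ∈ before D x
  precedes {z ∷ D} (z∉ ∷ D!) (_ ∷ʳ s) rewrite before-there D (∈-≢ z∉ (Sublist.lookup s (here refl))) =
    precedes D! s
  precedes {z ∷ D} (z∉ ∷ D!) (refl ∷ s) rewrite before-here z D = Sublist.lookup s (here refl)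

module _ {n} (G : Graph n) where
  open Graph G

  earlier : List (Fin n) → Fin n → List (Fin n)
  earlier D v = filter (v ∼?_) (before D v)

  -- Every vertex is a root or is joined exactly to its parent p and to the earlier
  -- neighbours of p, so G is the transitive closure of the forest of these parents.
  data Nested : List (Fin n) → Set where
    []    : Nested []
    root  : ∀ {v D} → Nested D → filter (v ∼?_) D ≡ [] → Nested (v ∷ D)
    child : ∀ {v D} p → Nested D → filter (v ∼?_) D ≡ p ∷ earlier D p → Nested (v ∷ D)

  nested-tail : ∀ {v D} → Nested (v ∷ D) → Nested D
  nested-tail (root nest _)    = nest
  nested-tail (child _ nest _) = nest

  earlier-here : ∀ v D → earlier (v ∷ D) v ≡ filter (v ∼?_) D
  earlier-here v D = cong (filter (v ∼?_)) (before-here v D)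

  earlier-there : ∀ {v x D} → All (x ≢_) D → v ∈ D → earlier (x ∷ D) v ≡ earlier D v
  earlier-there {v} {D = D} x∉ v∈ = cong (filter (v ∼?_)) (before-there D (∈-≢ x∉ v∈))

  earlier⇒∈ : ∀ D {c a} → a ∈ earlier D c → a ∈ D
  earlier⇒∈ D {c} a∈ = before⊆ D (proj₁ (∈-filter⁻ (c ∼?_) a∈))

  earlier⇒∼ : ∀ D {c a} → a ∈ earlier D c → c ∼ a
  earlier⇒∼ D {c} a∈ = proj₂ (∈-filter⁻ (c ∼?_) {xs = before D c} a∈)

  private
    parent∈ : ∀ {v p r D} → filter (v ∼?_) D ≡ p ∷ r → p ∈ D
    parent∈ {v} eq = proj₁ (∈-filter⁻ (v ∼?_) (subst (_ ∈_) (sym eq) (here refl)))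

  -- The members of `earlier D c` are the ancestors of c: b is the parent p of c or an ancestor of
  -- p, where the induction continues.
  earlier-trans : ∀ {D c b a} → Nested D → Unique D → c ∈ D →
                  b ∈ earlier D c → a ∈ earlier D b → a ∈ earlier D c
  earlier-trans {x ∷ D} {c} (root nest eq) (x∉ ∷ D!) (here refl) b∈ a∈
    rewrite earlier-here x D | eq with () ← b∈
  earlier-trans {x ∷ D} {c} {b} (child p nest eq) (x∉ ∷ D!) (here refl) b∈ a∈
    rewrite earlier-here x D | eq with b∈
  ... | here refl rewrite earlier-there x∉ (parent∈ eq) = there a∈
  ... | there b∈p rewrite earlier-there x∉ (earlier⇒∈ D b∈p) =
    there (earlier-trans nest D! (parent∈ eq) b∈p a∈)
  earlier-trans {x ∷ D} {c} {b} nest′ (x∉ ∷ D!) (there c∈) b∈ a∈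
    rewrite earlier-there x∉ c∈ | earlier-there x∉ (earlier⇒∈ D b∈) =
    earlier-trans (nested-tail nest′) D! c∈ b∈ a∈

  -- The ancestors of c form a chain: its parent has all the others among its own ancestors, and
  -- those are comparable by induction.
  earlier-comparable : ∀ {D c a b} → Nested D → Unique D → c ∈ D → a ∈ earlier D c → b ∈ earlier D c →
                       a ≡ b ⊎ a ∈ earlier D b ⊎ b ∈ earlier D a
  earlier-comparable {x ∷ D} (root _ eq) (x∉ ∷ D!) (here refl) a∈ b∈
    rewrite earlier-here x D | eq with () ← a∈
  earlier-comparable {x ∷ D} (child p nest eq) (x∉ ∷ D!) (here refl) a∈ b∈
    rewrite earlier-here x D | eq with a∈ | b∈
  ... | here refl | here refl = inj₁ refl
  ... | here refl | there b∈p rewrite earlier-there x∉ (parent∈ eq) = inj₂ (inj₂ b∈p)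
  ... | there a∈p | here refl rewrite earlier-there x∉ (parent∈ eq) = inj₂ (inj₁ a∈p)
  ... | there a∈p | there b∈p
    rewrite earlier-there x∉ (earlier⇒∈ D a∈p) | earlier-there x∉ (earlier⇒∈ D b∈p) =
    earlier-comparable nest D! (parent∈ eq) a∈p b∈p
  earlier-comparable {x ∷ D} nest (x∉ ∷ D!) (there c∈) a∈ b∈
    rewrite earlier-there x∉ c∈ | earlier-there x∉ (earlier⇒∈ D a∈) | earlier-there x∉ (earlier⇒∈ D b∈) =
    earlier-comparable (nested-tail nest) D! c∈ a∈ b∈

  edge-earlier : ∀ {D a b} → Unique D → a ∈ D → b ∈ D → a ∼ b → a ∈ earlier D b ⊎ b ∈ earlier D a
  edge-earlier {a = a} _ (here refl) (here refl) a∼b = ⊥-elim (irrefl a a∼b)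
  edge-earlier {a ∷ D} _ (here refl) (there b∈) a∼b rewrite earlier-here a D =
    inj₂ (∈-filter⁺ (a ∼?_) b∈ a∼b)
  edge-earlier {b ∷ D} _ (there a∈) (here refl) a∼b rewrite earlier-here b D =
    inj₁ (∈-filter⁺ (b ∼?_) a∈ (symm a∼b))
  edge-earlier {x ∷ D} (x∉ ∷ D!) (there a∈) (there b∈) a∼b
    rewrite earlier-there x∉ a∈ | earlier-there x∉ b∈ = edge-earlier D! a∈ b∈ a∼b

  module _ {D : List (Fin n)} (nest : Nested D) (D! : Unique D) (full : ∀ v → v ∈ D) where

    -- A neighbour c of b is a descendant of b, hence of a, or an ancestor of b, hence comparable
    -- with the ancestor a.
    nested-neighbours : ∀ {a b c} → a ∈ earlier D b → c ∼ b → c ≡ a ⊎ c ∼ a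
    nested-neighbours {a} {b} {c} a∈ c∼b with edge-earlier D! (full c) (full b) c∼b
    ... | inj₂ b∈ = inj₂ (earlier⇒∼ D (earlier-trans nest D! (full c) b∈ a∈))
    ... | inj₁ c∈ with earlier-comparable nest D! (full b) c∈ a∈
    ...   | inj₁ c≡a         = inj₁ c≡a
    ...   | inj₂ (inj₁ c∈a)  = inj₂ (symm (earlier⇒∼ D c∈a))
    ...   | inj₂ (inj₂ a∈c)  = inj₂ (earlier⇒∼ D a∈c)

    -- One end of an edge is an ancestor of the other, and the descendant has no private neighbour.
    no-crossing-edge : ∀ {x a b y} → a ∼ b → x ∼ a → ¬ x ∼ b → x ≢ b → y ∼ b → ¬ y ∼ a → y ≢ a → ⊥
    no-crossing-edge a∼b x∼a x≁b x≢b y∼b y≁a y≢a with edge-earlier D! (full _) (full _) a∼b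
    ... | inj₁ a∈ = Sum.[ y≢a , y≁a ] (nested-neighbours a∈ y∼b)
    ... | inj₂ b∈ = Sum.[ x≢b , x≁b ] (nested-neighbours b∈ x∼a)

    nested⇒triviallyPerfect : TriviallyPerfect G
    nested⇒triviallyPerfect =
      excluded C₄ (inj₁ refl) (inj₁ refl) (inj₁ refl)
        (λ { (inj₁ ()) ; (inj₂ ()) }) (λ { (inj₁ ()) ; (inj₂ ()) })
      , excluded P₄ (inj₁ refl) (inj₁ refl) (inj₁ refl)
        (λ { (inj₁ ()) ; (inj₂ ()) }) (λ { (inj₁ ()) ; (inj₂ ()) })
      where
      -- C₄ and P₄ agree on these five pairs, which already give the middle edge a private neighbour
      -- at each end.
      excluded : (H : Graph 4) → let module H = Graph H in
        zero H.∼ suc zero → suc zero H.∼ suc (suc zero) → suc (suc zero) H.∼ suc (suc (suc zero)) →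
        ¬ zero H.∼ suc (suc zero) → ¬ suc zero H.∼ suc (suc (suc zero)) → ¬ ∃ (InducedCopy H G)
      excluded H e₀₁ e₁₂ e₂₃ ¬e₀₂ ¬e₁₃ (f , copy) =
        no-crossing-edge (to e₁₂) (to e₀₁) (¬e₀₂ ∘ from) (λ eq → contradiction (injective eq) λ ())
          (symm (to e₂₃)) (¬e₁₃ ∘ from ∘ symm) (λ eq → contradiction (injective eq) λ ())
        where
        open InducedCopy copy
        to : ∀ {i j} → Graph._∼_ H i j → f i ∼ f j
        to = Equivalence.to (induced _ _)
        from : ∀ {i j} → f i ∼ f j → Graph._∼_ H i j
        from = Equivalence.from (induced _ _)

  -- The first pattern contradicts the transitivity of ancestry, the second the fact that the
  -- ancestors of c form a chain.
  nested⇒avoiding : ∀ {order} → Nested (reverse order) → Unique (reverse order) →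
                    (∀ v → v ∈ reverse order) → AvoidingOrder G order
  nested⇒avoiding {order} nest D! full = record
    { enumerates = ↭-trans (↭-sym (↭-reverse order))
        (unique-↭ D! (Unique.allFin⁺ n) (λ _ → ∈-allFin _) (λ _ → full _))
    ; avoids₁ = λ {a} {b} {c} s (a∼b , b∼c , a≁c) →
        a≁c (symm (earlier⇒∼ D (earlier-trans nest D! (full c)
          (∈-filter⁺ (c ∼?_) (precedes D! (Sublist.⊆-trans (refl ∷ refl ∷ (a ∷ʳ [])) (rev s))) (symm b∼c))
          (∈-filter⁺ (b ∼?_) (precedes D! (Sublist.⊆-trans (c ∷ʳ refl ∷ refl ∷ []) (rev s))) (symm a∼b)))))
    ; avoids₂ = λ {a} {b} {c} s (a∼c , b∼c , a≁b) →
        avoid₂ (earlier-comparable nest D! (full c)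
          (∈-filter⁺ (c ∼?_) (precedes D! (Sublist.⊆-trans (refl ∷ (b ∷ʳ refl ∷ [])) (rev s))) (symm a∼c))
          (∈-filter⁺ (c ∼?_) (precedes D! (Sublist.⊆-trans (refl ∷ refl ∷ (a ∷ʳ [])) (rev s))) (symm b∼c)))
          (precedes D! (Sublist.⊆-trans (c ∷ʳ refl ∷ refl ∷ []) (rev s))) a≁b
    }
    where
    D = reverse order
    rev : ∀ {a b c} → a ∷ b ∷ c ∷ [] ⊆ order → c ∷ b ∷ a ∷ [] ⊆ D
    rev = Sublist.reverse⁺ (setoid (Fin n))
    avoid₂ : ∀ {a b} → a ≡ b ⊎ a ∈ earlier D b ⊎ b ∈ earlier D a → a ∈ before D b → ¬ a ∼ b → ⊥
    avoid₂ (inj₁ refl) a∈ _ = ∉-before D! a∈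
    avoid₂ (inj₂ (inj₁ a∈b)) _ a≁b = a≁b (symm (earlier⇒∼ D a∈b))
    avoid₂ (inj₂ (inj₂ b∈a)) _ a≁b = a≁b (earlier⇒∼ D b∈a)

  -- Search orders that prefer large degrees

  -- The trace that the choice of largest degrees leaves on a search order:
  -- a vertex w that was not chosen, though its degree exceeds that of a, is
  -- missed by the vertex p from which a was reached.
  Greedy : List (Fin n) → Set
  Greedy []      = ⊤
  Greedy (a ∷ D) = All (a ≢_) D × Greedy D ×
    (∀ w → w ∉ a ∷ D → degree w ≤ degree a ⊎ ∃[ p ] (p ∈ D × p ∼ a × ¬ p ∼ w))

  greedy⇒unique : ∀ D → Greedy D → Unique D
  greedy⇒unique []      _            = []
  greedy⇒unique (a ∷ D) (a∉ , g , _) = a∉ ∷ greedy⇒unique D g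

  greedy-ʳ++⁻ : ∀ vs {D} → Greedy (vs ʳ++ D) → Greedy D
  greedy-ʳ++⁻ []       g = g
  greedy-ʳ++⁻ (v ∷ vs) g = proj₁ (proj₂ (greedy-ʳ++⁻ vs g))

  greedy-before : ∀ {D} v → Greedy D → Greedy (before D v)
  greedy-before {[]}    v g = g
  greedy-before {x ∷ D} v (_ , g , _) with v Fin.≟ x
  ... | yes _ = g
  ... | no _  = greedy-before v g

  -- The second conclusion keeps v visited through all deeper calls: v is the witness p for every
  -- vertex that it reaches.
  explore-greedy : ∀ {S v S₂} → Explore G S v S₂ → v ∈ S → Greedy S →
                   Greedy S₂ × (∀ {w} → w ∈ S → w ∈ S₂)
  explore-greedy (return _) v∈ g = g , id
  explore-greedy {S} {v} {S₂} (descend {u} {S₁} ((v∼u , u∉) , largest) ex₁ ex₂) v∈ g =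
    proj₁ after₂ , proj₂ after₂ ∘ proj₂ after₁ ∘ there
    where
    -- u is largest among the unvisited neighbours of v, so a vertex of larger degree that was
    -- passed over is not adjacent to v.
    chosen : ∀ w → w ∉ u ∷ S → degree w ≤ degree u ⊎ ∃[ p ] (p ∈ S × p ∼ u × ¬ p ∼ w)
    chosen w w∉ with v ∼? w
    ... | yes v∼w = inj₁ (largest w (v∼w , w∉ ∘ there))
    ... | no v≁w  = inj₂ (v , v∈ , v∼u , v≁w)
    after₁ : Greedy S₁ × (∀ {w} → w ∈ u ∷ S → w ∈ S₁)
    after₁ = explore-greedy ex₁ (here refl)
      (All.tabulate (λ w∈ u≡w → u∉ (subst (_∈ S) (sym u≡w) w∈)) , g , chosen)
    after₂ : Greedy S₂ × (∀ {w} → w ∈ S₁ → w ∈ S₂)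
    after₂ = explore-greedy ex₂ (proj₂ after₁ (there v∈)) (proj₁ after₁)

  search-greedy : ∀ {S S₂} → Search G S S₂ → Greedy S → Greedy S₂ × (∀ w → w ∈ S₂)
  search-greedy (finish full) g = g , full
  search-greedy {S} (start {u} (u∉ , largest) ex s) g =
    search-greedy s (proj₁ (explore-greedy ex (here refl)
      (All.tabulate (λ w∈ u≡w → u∉ (subst (_∈ S) (sym u≡w) w∈)) , g ,
       λ w w∉ → inj₁ (largest w (w∉ ∘ there)))))

  -- The recursion goes back to the moment when a was visited. Then b was still unvisited while p
  -- had been visited, whence `p ≢ b`.
  greedy-choice : ∀ {D a b} → Greedy D → a ∈ D → b ∉ D →
                  degree b ≤ degree a ⊎ ∃[ p ] (p ∼ a × ¬ p ∼ b × p ≢ b)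
  greedy-choice (_ , _ , chosen) (here refl) b∉ =
    Sum.map₂ (λ (p , p∈ , p∼a , p≁b) → p , p∼a , p≁b , λ p≡b → b∉ (there (subst (_∈ _) p≡b p∈))) (chosen _ b∉)
  greedy-choice (_ , g , _) (there a∈) b∉ = greedy-choice g a∈ (b∉ ∘ there)

  -- Edges with incomparable neighbourhoods and the forbidden subgraphs

  Private : Fin n → Fin n → Fin n → Set
  Private a b x = x ∼ a × ¬ x ∼ b × x ≢ b

  -- If no vertex were private to a, then N[a] together with x would fit into N[b], giving degree a
  -- < degree b. One alternative of `greedy-choice` contradicts this; the other names a private
  -- neighbour outright. The count names none, hence the double negation.
  greedy-crossing : ∀ {D a b x} → Greedy D → a ∈ D → b ∉ D → a ∼ b → Private b a x →
                    ¬ (∀ y → ¬ Private a b y)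
  greedy-crossing {D} {a} {b} {x} g a∈ b∉ a∼b (x∼b , x≁a , x≢a) dominated with greedy-choice g a∈ b∉
  ... | inj₂ (p , priv) = dominated p priv
  ... | inj₁ b≤a = ℕ.<⇒≱ (ℕ.≤-<-trans b≤a (ℕ.n<1+n _)) (ℕ.≤-pred
          (unique-length ((x≢a ∷ All.tabulate (λ w∈ x≡w → x≁a (symm (subst (a ∼_) (sym x≡w) (N⇒∼ w∈))))) ∷
                          All.tabulate (λ w∈ a≡w → irrefl a (subst (a ∼_) (sym a≡w) (N⇒∼ w∈))) ∷ N! a) sub))
    where
    N : Fin n → List (Fin n)
    N v = filter (v ∼?_) (allFin n)
    N! : ∀ v → Unique (N v)
    N! v = Unique.filter⁺ (v ∼?_) (Unique.allFin⁺ n)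
    ∼⇒N : ∀ {v w} → v ∼ w → w ∈ N v
    ∼⇒N {v} v∼w = ∈-filter⁺ (v ∼?_) (∈-allFin _) v∼w
    N⇒∼ : ∀ {v w} → w ∈ N v → v ∼ w
    N⇒∼ {v} w∈ = proj₂ (∈-filter⁻ (v ∼?_) {xs = allFin n} w∈)
    sub : ∀ {w} → w ∈ x ∷ a ∷ N a → w ∈ b ∷ N b
    sub (here refl)         = there (∼⇒N (symm x∼b))
    sub (there (here refl)) = there (∼⇒N (symm a∼b))
    sub {w} (there (there w∈)) with w Fin.≟ b | w ∼? b
    ... | yes w≡b | _       = here w≡b
    ... | no _    | yes w∼b = there (∼⇒N (symm w∼b))
    ... | no w≢b  | no w≁b  = ⊥-elim (dominated w (symm (N⇒∼ w∈) , w≁b , w≢b))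

  quadruple : Fin n → Fin n → Fin n → Fin n → Fin 4 → Fin n
  quadruple x a b y zero                   = x
  quadruple x a b y (suc zero)             = a
  quadruple x a b y (suc (suc zero))       = b
  quadruple x a b y (suc (suc (suc zero))) = y

  module _ {x a b y} (a∼b : a ∼ b) (x-priv : Private a b x) (y-priv : Private b a y) where
    private
      x∼a = proj₁ x-priv ; x≁b = proj₁ (proj₂ x-priv) ; x≢b = proj₂ (proj₂ x-priv)
      y∼b = proj₁ y-priv ; y≁a = proj₁ (proj₂ y-priv) ; y≢a = proj₂ (proj₂ y-priv)

      ∼⇒≢ : ∀ {u v} → u ∼ v → u ≢ v
      ∼⇒≢ {u} u∼v refl = irrefl u u∼v

      -- The two targets differ only at the ends 0 and 3, so that pair is a parameter; all other
      -- pairs are those of a path x a b y without the chords xb and ay.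
      path-copy : (H : Graph 4) → let module H = Graph H in
        zero H.∼ suc zero → suc zero H.∼ suc (suc zero) → suc (suc zero) H.∼ suc (suc (suc zero)) →
        ¬ zero H.∼ suc (suc zero) → ¬ suc zero H.∼ suc (suc (suc zero)) →
        (zero H.∼ suc (suc (suc zero)) ⇔ x ∼ y) → InducedCopy H G (quadruple x a b y)
      path-copy H e₀₁ e₁₂ e₂₃ ¬e₀₂ ¬e₁₃ e₀₃ = record { injective = inj _ _ ; induced = ind }
        where
        module H = Graph H
        both : ∀ {P Q : Set} → P → Q → P ⇔ Q
        both p q = mk⇔ (λ _ → q) (λ _ → p)
        neither : ∀ {P Q : Set} → ¬ P → ¬ Q → P ⇔ Q
        neither ¬p ¬q = mk⇔ (⊥-elim ∘ ¬p) (⊥-elim ∘ ¬q)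
        f = quadruple x a b y
        x≢y : x ≢ y
        x≢y refl = y≁a x∼a
        inj : ∀ i j → f i ≡ f j → i ≡ j
        inj zero zero _ = refl
        inj zero (suc zero) eq = ⊥-elim (∼⇒≢ x∼a eq)
        inj zero (suc (suc zero)) eq = ⊥-elim (x≢b eq)
        inj zero (suc (suc (suc zero))) eq = ⊥-elim (x≢y eq)
        inj (suc zero) zero eq = ⊥-elim (∼⇒≢ x∼a (sym eq))
        inj (suc zero) (suc zero) _ = refl
        inj (suc zero) (suc (suc zero)) eq = ⊥-elim (∼⇒≢ a∼b eq)
        inj (suc zero) (suc (suc (suc zero))) eq = ⊥-elim (y≢a (sym eq))
        inj (suc (suc zero)) zero eq = ⊥-elim (x≢b (sym eq))
        inj (suc (suc zero)) (suc zero) eq = ⊥-elim (∼⇒≢ a∼b (sym eq))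
        inj (suc (suc zero)) (suc (suc zero)) _ = refl
        inj (suc (suc zero)) (suc (suc (suc zero))) eq = ⊥-elim (∼⇒≢ y∼b (sym eq))
        inj (suc (suc (suc zero))) zero eq = ⊥-elim (x≢y (sym eq))
        inj (suc (suc (suc zero))) (suc zero) eq = ⊥-elim (y≢a eq)
        inj (suc (suc (suc zero))) (suc (suc zero)) eq = ⊥-elim (∼⇒≢ y∼b eq)
        inj (suc (suc (suc zero))) (suc (suc (suc zero))) _ = refl
        ind : ∀ i j → (i H.∼ j) ⇔ (f i ∼ f j)
        ind zero zero = neither (H.irrefl _) (irrefl _)
        ind zero (suc zero) = both e₀₁ x∼a
        ind zero (suc (suc zero)) = neither ¬e₀₂ x≁b
        ind zero (suc (suc (suc zero))) = e₀₃
        ind (suc zero) zero = both (H.symm e₀₁) (symm x∼a)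
        ind (suc zero) (suc zero) = neither (H.irrefl _) (irrefl _)
        ind (suc zero) (suc (suc zero)) = both e₁₂ a∼b
        ind (suc zero) (suc (suc (suc zero))) = neither ¬e₁₃ (y≁a ∘ symm)
        ind (suc (suc zero)) zero = neither (¬e₀₂ ∘ H.symm) (x≁b ∘ symm)
        ind (suc (suc zero)) (suc zero) = both (H.symm e₁₂) (symm a∼b)
        ind (suc (suc zero)) (suc (suc zero)) = neither (H.irrefl _) (irrefl _)
        ind (suc (suc zero)) (suc (suc (suc zero))) = both e₂₃ (symm y∼b)
        ind (suc (suc (suc zero))) zero = mk⇔ (symm ∘ Equivalence.to e₀₃ ∘ H.symm) (H.symm ∘ Equivalence.from e₀₃ ∘ symm)
        ind (suc (suc (suc zero))) (suc zero) = neither (¬e₁₃ ∘ H.symm) y≁a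
        ind (suc (suc (suc zero))) (suc (suc zero)) = both (H.symm e₂₃) y∼b
        ind (suc (suc (suc zero))) (suc (suc (suc zero))) = neither (H.irrefl _) (irrefl _)

    crossing-copy : InducedCopy C₄ G (quadruple x a b y) ⊎ InducedCopy P₄ G (quadruple x a b y)
    crossing-copy with x ∼? y
    ... | yes x∼y = inj₁ (path-copy C₄ (inj₁ refl) (inj₁ refl) (inj₁ refl) (λ { (inj₁ ()) ; (inj₂ ()) })
                      (λ { (inj₁ ()) ; (inj₂ ()) }) (mk⇔ (λ _ → x∼y) (λ _ → inj₂ refl)))
    ... | no x≁y  = inj₂ (path-copy P₄ (inj₁ refl) (inj₁ refl) (inj₁ refl) (λ { (inj₁ ()) ; (inj₂ ()) })
                      (λ { (inj₁ ()) ; (inj₂ ()) }) (mk⇔ (λ { (inj₁ ()) ; (inj₂ ()) }) (⊥-elim ∘ x≁y)))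

    crossing-answer : CorrectAnswer G (cons (num 0) (encode (x ∷ a ∷ b ∷ y ∷ [])))
    crossing-answer = reject {f = quadruple x a b y} not-perfect crossing-copy
      where
      not-perfect : ¬ TriviallyPerfect G
      not-perfect (no-C₄ , no-P₄) = Sum.[ (λ c → no-C₄ (_ , c)) , (λ c → no-P₄ (_ , c)) ] crossing-copy

-- The maxDFS program.  Array 1 holds the buckets of equal degree, array 2 the
-- adjacency lists by decreasing degree and array 3 the visited flags; register 9
-- collects the vertices by decreasing degree and register 13 the visited ones.

push : Program
push = 2 [ var 7 ]:= pair (var 5) (2 [ var 7 ])

pushToNeighbours : Program
pushToNeighbours =
  6 := 0 [ var 5 ] ⨾
  forEach 6 7 push

countdown : Program
countdown = while lit 0 << var 2 loop (2 := prec (var 2) ⨾ 3 := pair (var 2) (var 3))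

vertices : Program
vertices =
  2 := var 0 ⨾
  countdown

addToBucket : Program
addToBucket =
  8 := lit 0 ⨾
  6 := 0 [ var 5 ] ⨾
  forEach 6 7 (8 := succ (var 8)) ⨾
  1 [ var 8 ]:= pair (var 5) (1 [ var 8 ])

fillBuckets : Program
fillBuckets =
  4 := var 3 ⨾
  forEach 4 5 addToBucket

addVertex : Program
addVertex =
  9 := pair (var 5) (var 9) ⨾
  pushToNeighbours

addBucket : Program
addBucket =
  12 := 1 [ var 11 ] ⨾
  forEach 12 5 addVertex

-- Every push goes to the front of a list, so taking the buckets by increasing degree leaves every
-- list decreasing; one global sort thus serves all adjacency lists. The vertex list in register 3
-- doubles as the list of the possible degrees, which are below n.
sortLists : Program
sortLists =
  10 := var 3 ⨾
  forEach 10 11 addBucket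

-- Register 4 is the stack of the unread remainders of the sorted lists.
searchBody : Program
searchBody =
  if pair? (fst (var 4)) then (
    5 := fst (fst (var 4)) ⨾
    4 := pair (snd (fst (var 4))) (snd (var 4)) ⨾
    if (3 [ var 5 ]) == lit 0 then (
      3 [ var 5 ]:= lit 1 ⨾
      13 := pair (var 5) (var 13) ⨾
      4 := pair (2 [ var 5 ]) (var 4))
    else skip)
  else (4 := snd (var 4))

searchLoop : Program
searchLoop = while pair? (var 4) loop searchBody

-- The bottom of the stack is the sorted list of all vertices, as if a virtual root were adjacent to
-- everything; restarts in new components need no loop of their own. The last loop reverses the
-- result, which was collected latest first.
maxDFS : Program
maxDFS =
  vertices ⨾
  fillBuckets ⨾
  sortLists ⨾
  4 := pair (var 9) nil ⨾
  searchLoop ⨾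
  forEach 13 5 (1 := pair (var 5) (var 1))

-- The order produced by bucket sort

module _ {A : Set} where

  allPairs-reverse : ∀ {R : A → A → Set} {xs} → AllPairs R xs → AllPairs (λ x y → R y x) (reverse xs)
  allPairs-reverse {R} {xs} rs = onto rs [] (All.universal (λ _ → []) xs)
    where
    onto : ∀ {xs ys} → AllPairs R xs → AllPairs (λ x y → R y x) ys → All (λ x → All (λ y → R y x) ys) xs →
           AllPairs (λ x y → R y x) (xs ʳ++ ys)
    onto [] ss [] = ss
    onto (r ∷ rs) ss (s ∷ ys<xs) = onto rs (s ∷ ss) (All.zipWith (λ (x<x′ , ys<x′) → x<x′ ∷ ys<x′) (r , ys<xs))

  unique-reverse : ∀ {xs : List A} → Unique xs → Unique (reverse xs)
  unique-reverse xs! = AllPairs.map (_∘ sym) (allPairs-reverse xs!)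

  allPairs-∈ : ∀ {R : A → A → Set} xs → (∀ {x y} → x ∈ xs → y ∈ xs → R x y) → AllPairs R xs
  allPairs-∈ []       r = []
  allPairs-∈ (x ∷ xs) r = All.tabulate (λ y∈ → r (here refl) (there y∈)) ∷ allPairs-∈ xs (λ x∈ y∈ → r (there x∈) (there y∈))

  unique-ʳ++⁻ : ∀ xs {ys : List A} → Unique (xs ʳ++ ys) → All (λ x → All (x ≢_) ys) xs × Unique ys
  unique-ʳ++⁻ []       ys! = [] , ys!
  unique-ʳ++⁻ (x ∷ xs) xs! with xs∉ , x∉ ∷ ys! ← unique-ʳ++⁻ xs xs! = x∉ ∷ All.map All.tail xs∉ , ys!

  unique-ʳ++-∉ : ∀ xs {v} {ys : List A} → Unique (xs ʳ++ v ∷ ys) → v ∉ xs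
  unique-ʳ++-∉ xs xs! v∈ with x≢v ∷ _ ← All.lookup (proj₁ (unique-ʳ++⁻ xs xs!)) v∈ = x≢v refl

slack : ∀ {a b} s → a + s ≡ b → a ≤ b
slack s eq = ℕ.≤-trans (ℕ.m≤m+n _ s) (ℕ.≤-reflexive eq)

module _ {n : ℕ} where

  array-other : ∀ (f : ℕ → Value) {v w : Fin n} {x} → w ≢ v → update f (toℕ v) x (toℕ w) ≡ f (toℕ w)
  array-other f w≢v = update-other f _ (w≢v ∘ Fin.toℕ-injective)

module _ {n} (G : Graph n) where
  open Graph G

  NeighboursIn : List (Fin n) → State → Set
  NeighboursIn D σ = ∀ w → arr σ 2 (toℕ w) ≡ encode (filter (w ∼?_) D)

  bucket : List (Fin n) → ℕ → List (Fin n)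
  bucket D k = filter (λ v → degree v ℕ.≟ k) D

  -- This follows the program: K lists the processed degrees latest first, hence largest first, and
  -- pushing the entries of a bucket one by one reverses it.
  byDegree : List (Fin n) → List (Fin n) → List (Fin n)
  byDegree U []      = []
  byDegree U (k ∷ K) = reverse (bucket U (toℕ k)) ++ byDegree U K

  Decreasing : List (Fin n) → Set
  Decreasing = AllPairs (λ u v → degree v ≤ degree u)

  degree<n : ∀ v → degree v < n
  degree<n v = subst (suc (degree v) ≤_) (List.length-tabulate {n = n} id)
    (unique-length {xs = v ∷ filter (v ∼?_) (allFin n)} {ys = allFin n}
      (All.tabulate (λ w∈ v≡w → irrefl v (subst (v ∼_) (sym v≡w) (proj₂ (∈-filter⁻ (v ∼?_) {xs = allFin n} w∈))))
        ∷ Unique.filter⁺ (v ∼?_) (Unique.allFin⁺ n))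
      (λ _ → ∈-allFin _))

  module _ {U : List (Fin n)} (U! : Unique U) (full : ∀ v → v ∈ U) where
    private
      bucket⇒degree : ∀ k {v} → v ∈ reverse (bucket U k) → degree v ≡ k
      bucket⇒degree k v∈ = proj₂ (∈-filter⁻ (λ v → degree v ℕ.≟ k) {xs = U} (∈-reverse v∈))

    byDegree⇒degree : ∀ K {v} → v ∈ byDegree U K → ∃[ k ] (k ∈ K × degree v ≡ toℕ k)
    byDegree⇒degree (k ∷ K) v∈ with ∈-++⁻ (reverse (bucket U (toℕ k))) v∈
    ... | inj₁ v∈b = k , here refl , bucket⇒degree (toℕ k) v∈b
    ... | inj₂ v∈D with k′ , k′∈ , v≡ ← byDegree⇒degree K v∈D = k′ , there k′∈ , v≡

    degree⇒byDegree : ∀ K {v k} → k ∈ K → degree v ≡ toℕ k → v ∈ byDegree U K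
    degree⇒byDegree (k ∷ K) {v} (here refl) v≡ = ∈-++⁺ˡ (∈-resp-↭ (↭-sym (↭-reverse _))
      (∈-filter⁺ (λ v → degree v ℕ.≟ toℕ k) (full v) v≡))
    degree⇒byDegree (k ∷ K) (there k∈) v≡ = ∈-++⁺ʳ (reverse (bucket U (toℕ k))) (degree⇒byDegree K k∈ v≡)

    byDegree-full : ∀ {K} → (∀ k → k ∈ K) → ∀ v → v ∈ byDegree U K
    byDegree-full {K} all v = degree⇒byDegree K (all (Fin.fromℕ< (degree<n v))) (sym (Fin.toℕ-fromℕ< (degree<n v)))

    byDegree-sorted : ∀ {K} → AllPairs (λ k k′ → k′ Fin.< k) K → Unique (byDegree U K) × Decreasing (byDegree U K)
    byDegree-sorted [] = [] , []
    byDegree-sorted {k ∷ K} (k> ∷ rest) with D! , dec ← byDegree-sorted rest =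
      Unique.++⁺ (unique-reverse (Unique.filter⁺ _ U!)) D!
        (λ (v∈b , v∈D) → ℕ.<-irrefl refl (below (bucket⇒degree _ v∈b) v∈D)) ,
      AllPairs.++⁺
        (allPairs-∈ _ (λ x∈ y∈ → ℕ.≤-reflexive (trans (bucket⇒degree _ y∈) (sym (bucket⇒degree _ x∈)))))
        dec
        (All.tabulate (λ u∈ → All.tabulate (λ v∈ → ℕ.<⇒≤ (below (bucket⇒degree _ u∈) v∈))))
      where
      below : ∀ {u v} → degree u ≡ toℕ k → v ∈ byDegree U K → degree v < degree u
      below u≡ v∈ with k′ , k′∈ , v≡ ← byDegree⇒degree K v∈ = subst₂ _<_ (sym v≡) (sym u≡) (All.lookup k> k′∈)

module _ {n} {G : Graph n} (L : AdjacencyLists G) where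
  open Graph G
  open AdjacencyLists L

  HasLists : State → Set
  HasLists σ = ∀ v → arr σ 0 (toℕ v) ≡ encode (neighbours v)

  input-lists : HasLists (input L)
  input-lists v with toℕ v <? n
  ... | yes v<n = cong (encode ∘ neighbours) (Fin.fromℕ<-toℕ v v<n)
  ... | no v≮n  = ⊥-elim (v≮n (Fin.toℕ<n v))

  length-neighbours : ∀ v → length (neighbours v) ≡ degree v
  length-neighbours v = ↭-length (unique-↭ (unique v) (Unique.filter⁺ (v ∼?_) (Unique.allFin⁺ n))
    (λ w∈ → ∈-filter⁺ (v ∼?_) (∈-allFin _) (Equivalence.to (complete v _) w∈))
    (λ w∈ → Equivalence.from (complete v _) (proj₂ (∈-filter⁻ (v ∼?_) {xs = allFin n} w∈))))

-- Execution of the sorting phase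

module _ {Returns : ℕ → Value → Set} {n : ℕ} where

  run-vertices : ∀ {σ} → reg σ 0 ≡ num n → reg σ 3 ≡ nil →
    Run Returns vertices σ (λ t σ′ → ∃[ vs ]
      (reg σ′ 3 ≡ encode {n} vs × AllPairs Fin._<_ vs × (∀ v → v ∈ vs) × t ≡ 2 + 3 * n))
  run-vertices {σ} n≡ nil≡ = assign⨾ n≡
    (weaken (go n [] ℕ.≤-refl refl nil≡ [] (λ v n≤v → ⊥-elim (ℕ.<⇒≱ (Fin.toℕ<n v) n≤v)) [])
      λ _ (vs , vs≡ , sorted , full , t≡) → vs , vs≡ , sorted , full , cong suc t≡)
    where
    tick : ∀ i → suc (2 + (1 + 3 * i)) ≡ 1 + 3 * suc i
    tick = solve-∀
    go : ∀ {σ} i vs → i ≤ n → reg σ 2 ≡ num i → reg σ 3 ≡ encode vs → AllPairs Fin._<_ vs →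
         (∀ v → i ≤ toℕ v → v ∈ vs) → All (λ v → i ≤ toℕ v) vs →
         Run Returns countdown σ (λ t σ′ → ∃[ vs ]
           (reg σ′ 3 ≡ encode {n} vs × AllPairs Fin._<_ vs × (∀ v → v ∈ vs) × t ≡ 1 + 3 * i))
    go 0 vs _ i≡ vs≡ sorted full _ =
      run-exit (cong (λ x → 0 <ᵇ toNum x) i≡) (vs , vs≡ , sorted , (λ v → full v z≤n) , refl)
    go {σ} (suc i) vs i<n i≡ vs≡ sorted full bounded =
      run-repeat {P = λ t σ′ → reg σ′ 2 ≡ num i × reg σ′ 3 ≡ encode (v ∷ vs) × t ≡ 2}
        (cong (λ x → 0 <ᵇ toNum x) i≡)
        (assign⨾ (cong (num ∘ pred ∘ toNum) i≡)
          (run-assign (cong₂ cons (cong num (sym v≡)) vs≡) (refl , refl , refl)))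
        λ { _ (i≡′ , vs≡′ , refl) → weaken
          (go i (v ∷ vs) (ℕ.<⇒≤ i<n) i≡′ vs≡′
            (All.map (λ {w} → ℕ.≤-trans (ℕ.≤-reflexive (cong suc v≡))) bounded ∷ sorted)
            full′
            (ℕ.≤-reflexive (sym v≡) ∷ All.map ℕ.<⇒≤ bounded))
          λ _ (vs′ , vs≡″ , sorted′ , full″ , t≡) →
            vs′ , vs≡″ , sorted′ , full″ , trans (cong (λ t → suc (2 + t)) t≡) (tick i) }
      where
      v : Fin n
      v = Fin.fromℕ< i<n
      v≡ : toℕ v ≡ i
      v≡ = Fin.toℕ-fromℕ< i<n
      full′ : ∀ w → i ≤ toℕ w → w ∈ v ∷ vs
      full′ w i≤w with toℕ w ℕ.≟ i
      ... | yes w≡i = here (Fin.toℕ-injective (trans w≡i (sym v≡)))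
      ... | no w≢i  = there (full w (ℕ.≤∧≢⇒< i≤w (w≢i ∘ sym)))

module _ {Returns : ℕ → Value → Set} {n} {G : Graph n} (L : AdjacencyLists G) where
  open Graph G
  open AdjacencyLists L

  -- Pushing v onto the lists of its neighbours extends D by v in all filters at once; since
  -- adjacency lists are duplicate-free, no list receives v twice. This serves both the sorting,
  -- with D ordered by degree, and the examination, with D the visited vertices.
  run-pushToNeighbours : ∀ {σ D} v → HasLists L σ → reg σ 5 ≡ num (toℕ v) → NeighboursIn G D σ →
    Run Returns pushToNeighbours σ (λ t σ′ → NeighboursIn G (v ∷ D) σ′ × t ≡ 2 + 4 * degree v)
  run-pushToNeighbours {σ} {D} v lists v≡ nbs =
    assign⨾ (trans (cong (arr σ 0 ∘ toNum) v≡) (lists v))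
      (weaken (run-forEach I (neighbours v) step refl (refl , λ w → (λ ()) , λ _ → nbs w))
        λ {_} {σ′} _ (τ≡ , pushed) →
          (λ w → final w (pushed w)) ,
          cong suc (trans τ≡ (cong (λ k → 1 + 4 * k) (trans (List.length-reverse (neighbours v)) (length-neighbours L v)))))
    where
    old : Fin n → List (Fin n)
    old w = filter (w ∼?_) D
    I : List (Fin n) → ℕ → State → Set
    I done τ σ′ = τ ≡ 1 + 4 * length done × (∀ w →
      (w ∈ done → arr σ′ 2 (toℕ w) ≡ encode (v ∷ old w)) × (w ∉ done → arr σ′ 2 (toℕ w) ≡ encode (old w)))
    tick : ∀ k → 1 + 4 * k + 4 ≡ 1 + 4 * suc k
    tick = solve-∀
    step : Iteration {Returns} 6 7 push (neighbours v) I (setReg 6 (encode (neighbours v)) σ)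
    step done _ σ′ w rest whole same (refl , pushed) =
      run-store refl (cong₂ cons (trans (regs same 5) v≡) (proj₂ (pushed w) w∉))
        (tick (length done) , λ u → into u , skipped u)
      where
      w∉ : w ∉ done
      w∉ = unique-ʳ++-∉ done (subst Unique (sym whole) (unique v))
      into : ∀ u → u ∈ w ∷ done → update (arr σ′ 2) (toℕ w) (encode (v ∷ old w)) (toℕ u) ≡ encode (v ∷ old u)
      into u u∈ with u Fin.≟ w | u∈
      ... | yes refl | _         = update-same (arr σ′ 2) (toℕ u) _
      ... | no u≢w   | here u≡w  = ⊥-elim (u≢w u≡w)
      ... | no u≢w   | there u∈′ = trans (array-other (arr σ′ 2) u≢w) (proj₁ (pushed u) u∈′)
      skipped : ∀ u → u ∉ w ∷ done → update (arr σ′ 2) (toℕ w) (encode (v ∷ old w)) (toℕ u) ≡ encode (old u)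
      skipped u u∉ = trans (array-other (arr σ′ 2) (u∉ ∘ here)) (proj₂ (pushed u) (u∉ ∘ there))
    final : ∀ w {x} → (w ∈ reverse (neighbours v) → x ≡ encode (v ∷ old w)) ×
            (w ∉ reverse (neighbours v) → x ≡ encode (old w)) →
            x ≡ encode (filter (w ∼?_) (v ∷ D))
    final w (hit , miss) with w ∼? v
    ... | yes w∼v = hit (∈-resp-↭ (↭-sym (↭-reverse _)) (Equivalence.from (complete v w) (symm w∼v)))
    ... | no w≁v  = miss (λ w∈ → w≁v (symm (Equivalence.to (complete v w) (∈-reverse w∈))))

  run-fillBuckets : ∀ {σ} vs → HasLists L σ → reg σ 3 ≡ encode vs → (∀ k → arr σ 1 k ≡ nil) →
    Run Returns fillBuckets σ (λ t σ′ →
      (∀ k → arr σ′ 1 k ≡ encode (bucket G (reverse vs) k)) × t ≤ 2 + 7 * weight G (reverse vs))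
  run-fillBuckets {σ} vs lists vs≡ empty =
    assign⨾ vs≡ (weaken (run-forEach I vs step refl (s≤s z≤n , empty)) λ _ (t≤ , filled) → filled , s≤s t≤)
    where
    I : List (Fin n) → ℕ → State → Set
    I done τ σ′ = τ ≤ 1 + 7 * weight G done × ∀ k → arr σ′ 1 k ≡ encode (bucket G done k)
    Counted : List (Fin n) → ℕ → State → Set
    Counted done τ σ′ = τ ≡ 1 + 4 * length done × reg σ′ 8 ≡ num (length done)
    tick : ∀ k → 1 + 4 * k + 4 ≡ 1 + 4 * suc k
    tick = solve-∀
    -- A vertex of degree d takes 7 + 4 d steps: three for the loop, two assignments, 1 + 4 d for
    -- counting its neighbours, and the store.
    bound : ∀ w d → 1 + 7 * w + (3 + suc (suc (1 + 4 * d + 1))) + 3 * d ≡ 1 + 7 * (suc d + w)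
    bound = solve-∀
    step : Iteration {Returns} 4 5 addToBucket vs I (setReg 4 (encode vs) σ)
    step done τ _ v rest whole same (τ≤ , filled) =
      assign⨾ refl (assign⨾ (trans (arrs same 0 (toℕ v)) (lists v))
        (run-forEach Counted (neighbours v)
           (λ { d _ _ w _ _ _ (refl , d≡) → run-assign (cong (num ∘ suc ∘ toNum) d≡) (tick (length d) , refl) })
           refl (refl , refl)
         andThen λ { {_} {σ″} same′ (refl , d≡) →
           run-store (cong toNum (trans d≡ (cong num counted)))
             (cong₂ cons (regs same′ 5) (trans (cong (arr σ″ 1 ∘ toNum) (trans d≡ (cong num counted)))
               (trans (arrs same′ 1 _) (filled _))))
             (ℕ.≤-trans (ℕ.≤-reflexive (cong (λ d → τ + (3 + suc (suc (1 + 4 * d + 1)))) counted))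
                (ℕ.≤-trans (ℕ.+-monoˡ-≤ _ τ≤) (slack (3 * degree v) (bound (weight G done) (degree v)))) ,
              put (arr σ″ 1) (λ k → trans (arrs same′ 1 k) (filled k))) }))
      where
      counted : length (reverse (neighbours v)) ≡ degree v
      counted = trans (List.length-reverse (neighbours v)) (length-neighbours L v)
      put : ∀ f → (∀ k → f k ≡ encode (bucket G done k)) → ∀ k →
            update f (degree v) (encode (v ∷ bucket G done (degree v))) k ≡ encode (bucket G (v ∷ done) k)
      put f f≡ k with degree v ℕ.≟ k
      ... | yes v≡k = subst 
        (λ k → update f (degree v) (encode (v ∷ bucket G done (degree v))) k ≡ encode (bucket G (v ∷ done) k)) v≡k
        (trans (update-same f (degree v) _) (cong encode (sym (List.filter-accept (λ u → degree u ℕ.≟ degree v) refl))))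
      ... | no v≢k  = trans (update-other f _ (v≢k ∘ sym))
        (trans (f≡ k) (cong encode (sym (List.filter-reject (λ u → degree u ℕ.≟ k) v≢k))))

  -- A vertex of degree d costs 6 + 4 d steps. Every bucket, even an empty one, costs 5 more: three
  -- for the outer loop, an assignment and the exit of the inner loop.
  run-sortLists : ∀ {σ} U vs → HasLists L σ → reg σ 3 ≡ encode vs →
    (∀ k → arr σ 1 k ≡ encode (bucket G U k)) → reg σ 9 ≡ nil → (∀ k → arr σ 2 k ≡ nil) →
    Run Returns sortLists σ (λ t σ′ → let D = byDegree G U (reverse vs) in
      reg σ′ 9 ≡ encode D × NeighboursIn G D σ′ × t ≤ 2 + 5 * length (reverse vs) + 6 * weight G D)
  run-sortLists {σ} U vs lists vs≡ buckets nil≡ empty =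
    assign⨾ vs≡ (weaken (run-forEach I vs outer refl (ℕ.≤-refl , nil≡ , (λ w → empty (toℕ w))))
      λ _ (t≤ , D≡ , nbs) → D≡ , nbs , s≤s t≤)
    where
    I : List (Fin n) → ℕ → State → Set
    I K τ σ′ = let D = byDegree G U K in
      τ ≤ 1 + 5 * length K + 6 * weight G D × reg σ′ 9 ≡ encode D × NeighboursIn G D σ′
    outer : Iteration {Returns} 10 11 addBucket vs I (setReg 10 (encode vs) σ)
    outer K τ σ′ k rest _ same (τ≤ , D≡ , nbs) =
      assign⨾ (trans (arrs same 1 (toℕ k)) (buckets (toℕ k)))
        (weaken (run-forEach J (bucket G U (toℕ k)) inner refl (ℕ.≤-refl , D≡ , nbs))
          λ _ (t≤ , D≡′ , nbs′) → outer-time t≤ , D≡′ , nbs′)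
      where
      D = byDegree G U K
      W = weight G D
      -- Here τ counts the steps of the current bucket alone; `6 * W` on the left stands for the
      -- earlier ones and avoids a subtraction.
      J : List (Fin n) → ℕ → State → Set
      J done τ σ′ =
        τ + 6 * W ≤ 1 + 6 * weight G (done ++ D) × reg σ′ 9 ≡ encode (done ++ D) × NeighboursIn G (done ++ D) σ′
      inner : Iteration {Returns} 12 5 addVertex (bucket G U (toℕ k)) J
                  (setReg 12 (encode (bucket G U (toℕ k))) (setReg 10 (encode rest) (setReg 11 (num (toℕ k)) σ′)))
      inner done τ _ v rest′ _ same′ (τ≤ , D≡ , nbs) =
        assign⨾ (cong (cons _) D≡)
          (weaken (run-pushToNeighbours v (λ w → trans (arrs same′ 0 _) (trans (arrs same 0 _) (lists w))) refl nbs)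
            λ { u (nbs′ , refl) → inner-time , regs u 9 , nbs′ })
        where
        bound : ∀ w d → 1 + 6 * w + (3 + suc (2 + 4 * d)) + 2 * d ≡ 1 + 6 * (suc d + w)
        bound = solve-∀
        shift : ∀ τ w c → τ + c + w ≡ τ + w + c
        shift = solve-∀
        inner-time : τ + (3 + suc (2 + 4 * degree v)) + 6 * W ≤ 1 + 6 * (suc (degree v) + weight G (done ++ D))
        inner-time = ℕ.≤-trans (ℕ.≤-reflexive (shift τ (6 * W) _)) (ℕ.≤-trans (ℕ.+-monoˡ-≤ _ τ≤)
          (slack (2 * degree v) (bound (weight G (done ++ D)) (degree v))))
      outer-time : ∀ {t} → t + 6 * W ≤ 1 + 6 * weight G (byDegree G U (k ∷ K)) →
        τ + (3 + suc t) ≤ 1 + 5 * suc (length K) + 6 * weight G (byDegree G U (k ∷ K))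
      outer-time {t} t≤ = ℕ.+-cancelʳ-≤ (6 * W) _ _ (ℕ.≤-trans (ℕ.≤-reflexive (lhs τ t (6 * W)))
        (ℕ.≤-trans (ℕ.+-monoʳ-≤ 4 (ℕ.+-mono-≤ τ≤ t≤))
          (ℕ.≤-reflexive (rhs (length K) (6 * W) (weight G (byDegree G U (k ∷ K)))))))
        where
        lhs : ∀ τ t w → τ + (3 + suc t) + w ≡ 4 + (τ + (t + w))
        lhs = solve-∀
        rhs : ∀ l w w′ → 4 + (1 + 5 * l + w + (1 + 6 * w′)) ≡ 1 + 5 * suc l + 6 * w′ + w
        rhs = solve-∀

-- The search loop traces a maxDFS

module _ {Returns : ℕ → Value → Set} {n} (G : Graph n)
         (D : List (Fin n)) (D! : Unique D) (full : ∀ v → v ∈ D) (sorted : Decreasing G D) where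
  open Graph G
  open DecMembership (Fin._≟_ {n}) using (_∈?_)

  row-of : Fin n → List (Fin n)
  row-of v = filter (v ∼?_) D

  -- The flags are read through `toNum` because an untouched cell holds `nil`, which counts as 0; no
  -- initialisation is required.
  record Visited (S : List (Fin n)) (stack : Value) (σ : State) : Set where
    field
      stack≡ : reg σ 4 ≡ stack
      out≡   : reg σ 13 ≡ encode S
      seen   : ∀ w → w ∈ S → toNum (arr σ 3 (toℕ w)) ≡ 1
      unseen : ∀ w → w ∉ S → toNum (arr σ 3 (toℕ w)) ≡ 0
      lists  : ∀ w → arr σ 2 (toℕ w) ≡ encode (row-of w)
      S!     : Unique S
  open Visited

  -- Exec relates a loop only to its final state; progress inside the loop is
  -- expressed by what it adds to the runs that follow.
  record Reaches (σ : State) (Q : ℕ → State → Set) : Set where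
    constructor reaches
    field
      {time}  : ℕ
      {final} : State
      extend  : ∀ {t σ″} → Exec Returns searchLoop final t 0 σ″ → Exec Returns searchLoop σ (time + t) 0 σ″
      post    : Q time final

  infixr 1 _thenReaches_
  _thenReaches_ : ∀ {σ P Q} → Reaches σ P → (∀ {t σ′} → P t σ′ → Reaches σ′ (λ t′ → Q (t + t′))) → Reaches σ Q
  _thenReaches_ {σ} (reaches {t} ext h) f with reaches {t′} ext′ h′ ← f h =
    reaches (λ {t″} {σ″} ex → subst (λ t → Exec Returns searchLoop σ t 0 σ″) (sym (ℕ.+-assoc t t′ t″)) (ext (ext′ ex))) h′

  reach-nothing : ∀ {σ Q} → Q 0 σ → Reaches σ Q
  reach-nothing = reaches id

  iterate : ∀ {σ Q} → test σ (pair? (var 4)) ≡ true → Run Returns searchBody σ (λ t → Q (suc t)) → Reaches σ Q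
  iterate continue (run ex h) = reaches (repeat continue ex) h

  pop : ∀ {S rest σ} → Visited S (cons nil rest) σ → Reaches σ (λ t σ′ → Visited S rest σ′ × t ≡ 3)
  pop vis = iterate (cong isCons (stack≡ vis))
    (run-false (cong (isCons ∘ first) (stack≡ vis))
      (run-assign (cong second (stack≡ vis)) (record
        { stack≡ = refl ; out≡ = out≡ vis ; seen = seen vis ; unseen = unseen vis
        ; lists = lists vis ; S! = S! vis } , refl)))

  skipVisited : ∀ {S u l rest σ} → u ∈ S → Visited S (cons (cons (num (toℕ u)) l) rest) σ →
    Reaches σ (λ t σ′ → Visited S (cons l rest) σ′ × t ≡ 6)
  skipVisited {u = u} {σ = σ} u∈ vis = iterate (cong isCons (stack≡ vis))
    (run-true (cong (isCons ∘ first) (stack≡ vis))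
      (assign⨾ (cong (first ∘ first) (stack≡ vis))
        (assign⨾ (cong (λ s → cons (second (first s)) (second s)) (stack≡ vis))
          (run-false (cong (Data.Nat._≡ᵇ 0) (seen vis u u∈))
            (run-skip (record
              { stack≡ = refl ; out≡ = out≡ vis ; seen = seen vis ; unseen = unseen vis
              ; lists = lists vis ; S! = S! vis } , refl))))))

  visit : ∀ {S u l rest σ} → u ∉ S → Visited S (cons (cons (num (toℕ u)) l) rest) σ →
    Reaches σ (λ t σ′ → Visited (u ∷ S) (cons (encode (row-of u)) (cons l rest)) σ′ × t ≡ 8)
  visit {S} {u = u} {σ = σ} u∉ vis = iterate (cong isCons (stack≡ vis))
    (run-true (cong (isCons ∘ first) (stack≡ vis))
      (assign⨾ (cong (first ∘ first) (stack≡ vis))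
        (assign⨾ (cong (λ s → cons (second (first s)) (second s)) (stack≡ vis))
          (run-true (cong (Data.Nat._≡ᵇ 0) (unseen vis u u∉))
            (store⨾ refl refl
              (assign⨾ (cong (cons _) (out≡ vis))
                (run-assign (cong (λ l → cons l _) (lists vis u)) (record
                  { stack≡ = refl ; out≡ = refl ; seen = seen′ ; unseen = unseen′ ; lists = lists vis
                  ; S! = All.tabulate (λ w∈ u≡w → u∉ (subst (_∈ S) (sym u≡w) w∈)) ∷ S! vis } , refl))))))))
    where
    seen′ : ∀ w → w ∈ u ∷ S → toNum (update (arr σ 3) (toℕ u) (num 1) (toℕ w)) ≡ 1
    seen′ w w∈ with w Fin.≟ u | w∈
    ... | yes refl | _        = cong toNum (update-same (arr σ 3) (toℕ u) _)
    ... | no w≢u   | here w≡u = ⊥-elim (w≢u w≡u)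
    ... | no w≢u   | there w∈S = trans (cong toNum (array-other (arr σ 3) w≢u)) (seen vis w w∈S)
    unseen′ : ∀ w → w ∉ u ∷ S → toNum (update (arr σ 3) (toℕ u) (num 1) (toℕ w)) ≡ 0
    unseen′ w w∉ = trans (cong toNum (array-other (arr σ 3) (w∉ ∘ here))) (unseen vis w (w∉ ∘ there))

  -- l is what remains of the decreasing list of the vertices satisfying P.
  record Pending (P : Fin n → Set) (S l : List (Fin n)) : Set where
    field
      covers : ∀ w → P w → w ∈ S ⊎ w ∈ l
      sound  : ∀ {w} → w ∈ l → P w
      order  : Decreasing G l
  open Pending

  pending-drop : ∀ {P S S′ u l} → Pending P S (u ∷ l) → (∀ {w} → w ∈ S → w ∈ S′) → u ∈ S′ → Pending P S′ l
  pending-drop {S′ = S′} {l = l} pend sub u∈ = record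
    { covers = λ w p → covers′ (covers pend w p)
    ; sound  = sound pend ∘ there
    ; order  = AllPairs.tail (order pend) }
    where
    covers′ : ∀ {w} → w ∈ _ ⊎ w ∈ _ ∷ l → w ∈ S′ ⊎ w ∈ l
    covers′ (inj₁ w∈)          = inj₁ (sub w∈)
    covers′ (inj₂ (here refl)) = inj₁ u∈
    covers′ (inj₂ (there w∈))  = inj₂ w∈

  -- Every eligible vertex is still in the unread part of the list, however many vertices were
  -- visited by calls in between, and the head of that part has the largest degree in it.
  pending-largest : ∀ {P S u l} → Pending P S (u ∷ l) → ∀ w → P w → w ∉ S → degree w ≤ degree u
  pending-largest pend w p w∉ with covers pend w p
  ... | inj₁ w∈          = ⊥-elim (w∉ w∈)
  ... | inj₂ (here refl) = ℕ.≤-refl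
  ... | inj₂ (there w∈)  = All.lookup (AllPairs.head (order pend)) w∈

  pending-row : ∀ {S} u → Pending (u ∼_) S (row-of u)
  pending-row u = record
    { covers = λ w u∼w → inj₂ (∈-filter⁺ (u ∼?_) (full w) u∼w)
    ; sound  = λ w∈ → proj₂ (∈-filter⁻ (u ∼?_) {xs = D} w∈)
    ; order  = AllPairs.filter⁺ (u ∼?_) sorted }

  -- Explore from a fixed vertex and Search have the same shape, which lets one
  -- induction on the loop produce derivations of both.
  record Traversal (P : Fin n → Set) (Trace : List (Fin n) → List (Fin n) → Set) : Set where
    field
      stop : ∀ {S} → (∀ w → P w → w ∈ S) → Trace S S
      next : ∀ {S S₁ S₂ u} → Largest G (λ w → P w × w ∉ S) u → Explore G (u ∷ S) u S₁ → Trace S₁ S₂ → Trace S S₂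
  open Traversal

  explore-traversal : ∀ v → Traversal (v ∼_) (λ S S₂ → Explore G S v S₂)
  explore-traversal v = record { stop = return ; next = descend }

  search-traversal : Traversal (λ _ → ⊤) (Search G)
  search-traversal = record
    { stop = λ all → finish (λ w → all w tt)
    ; next = λ ((_ , u∉) , largest) → start (u∉ , λ w w∉ → largest w (tt , w∉)) }

  -- The cost is amortised: 8 for each entry of l and `8 * suc (degree v)` for each newly visited v,
  -- whose degree pays for reading its own row. The weight of S stands on the left to avoid a
  -- subtraction.
  record Traversed (Trace : List (Fin n) → Set) (S l : List (Fin n)) (rest : Value) (t : ℕ) (σ : State) : Set where
    constructor traversed
    field
      {S₂}    : List (Fin n)
      trace   : Trace S₂
      grows   : ∀ {w} → w ∈ S → w ∈ S₂
      visited : Visited S₂ (cons nil rest) σ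
      cost    : t + 8 * weight G S ≤ 8 * (weight G S₂ + length l)

  row-length : ∀ u → length (row-of u) ≤ degree u
  row-length u = unique-length (Unique.filter⁺ (u ∼?_) D!)
    (λ w∈ → ∈-filter⁺ (u ∼?_) (∈-allFin _) (proj₂ (∈-filter⁻ (u ∼?_) {xs = D} w∈)))

  visited-length : ∀ {S stack σ} → Visited S stack σ → length S ≤ n
  visited-length {S} vis = subst (length S ≤_) (List.length-tabulate {n = n} id)
    (unique-length {ys = allFin n} (S! vis) (λ _ → ∈-allFin _))

  private
    -- A visit takes 8 steps and the later pop 3, while the list entry and the new vertex are worth
    -- 16, which leaves 5. Adding `8 * W₁ + 8 * d` to both sides allows the two hypotheses to be
    -- summed.
    visit-cost : ∀ {t₁ t₂ d r W W₁ W₂ m} → r ≤ d →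
      t₁ + 8 * (suc d + W) ≤ 8 * (W₁ + r) → t₂ + 8 * W₁ ≤ 8 * (W₂ + m) →
      8 + (t₁ + (3 + t₂)) + 8 * W ≤ 8 * (W₂ + suc m)
    visit-cost {t₁} {t₂} {d} {r} {W} {W₁} {W₂} {m} r≤d h₁ h₂ = ℕ.+-cancelʳ-≤ (8 * W₁ + 8 * d) _ _ (begin
      8 + (t₁ + (3 + t₂)) + 8 * W + (8 * W₁ + 8 * d)     ≡⟨ lhs t₁ t₂ d W W₁ ⟩
      3 + (t₁ + 8 * (suc d + W) + (t₂ + 8 * W₁))         ≤⟨ ℕ.+-monoʳ-≤ 3 (ℕ.+-mono-≤ h₁ h₂) ⟩
      3 + (8 * (W₁ + r) + 8 * (W₂ + m))
        ≤⟨ ℕ.+-monoʳ-≤ 3 (ℕ.+-monoˡ-≤ _ (ℕ.*-monoʳ-≤ 8 (ℕ.+-monoʳ-≤ W₁ r≤d))) ⟩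
      3 + (8 * (W₁ + d) + 8 * (W₂ + m))                  ≤⟨ ℕ.m≤n+m _ 5 ⟩
      5 + (3 + (8 * (W₁ + d) + 8 * (W₂ + m)))            ≡⟨ rhs d W₁ W₂ m ⟩
      8 * (W₂ + suc m) + (8 * W₁ + 8 * d) ∎)
      where
      open ℕ.≤-Reasoning
      lhs : ∀ t₁ t₂ d W W₁ → 8 + (t₁ + (3 + t₂)) + 8 * W + (8 * W₁ + 8 * d) ≡ 3 + (t₁ + 8 * (suc d + W) + (t₂ + 8 * W₁))
      lhs = solve-∀
      rhs : ∀ d W₁ W₂ m → 5 + (3 + (8 * (W₁ + d) + 8 * (W₂ + m))) ≡ 8 * (W₂ + suc m) + (8 * W₁ + 8 * d)
      rhs = solve-∀

    skip-cost : ∀ {t W W₂ m} → t + 8 * W ≤ 8 * (W₂ + m) → 6 + t + 8 * W ≤ 8 * (W₂ + suc m)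
    skip-cost {t} {W} {W₂} {m} h = ℕ.≤-trans (ℕ.+-monoʳ-≤ 6 h)
      (ℕ.≤-trans (ℕ.m≤n+m _ 2) (ℕ.≤-reflexive (rhs W₂ m)))
      where
      rhs : ∀ W₂ m → 2 + (6 + 8 * (W₂ + m)) ≡ 8 * (W₂ + suc m)
      rhs = solve-∀

  reweaken : ∀ {σ P Q} → Reaches σ P → (∀ {t σ′} → P t σ′ → Q t σ′) → Reaches σ Q
  reweaken (reaches ext h) f = reaches ext (f h)

  -- The list shrinks except at a visit, which opens a whole row. `fuel` bounds the number of
  -- vertices still to be visited; a visit without fuel would give more than n distinct visited
  -- vertices.
  traverse : ∀ fuel l {P Trace S rest σ} → Traversal P Trace → n ≤ length S + fuel → Pending P S l →
             Visited S (cons (encode l) rest) σ → Reaches σ (Traversed (Trace S) S l rest)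
  traverse-unvisited : ∀ fuel l {P Trace S rest σ u} → u ∉ S → Traversal P Trace →
    n ≤ length S + fuel → Pending P S (u ∷ l) →
    Visited (u ∷ S) (cons (encode (row-of u)) (cons (encode l) rest)) σ →
    Reaches σ (λ t → Traversed (Trace S) S (u ∷ l) rest (8 + t))

  traverse fuel [] {S = S} tr enough pend vis = reach-nothing
    (traversed (stop tr λ w p → Sum.[ id , (λ ()) ] (covers pend w p)) id vis
      (ℕ.≤-reflexive (cong (8 *_) (sym (ℕ.+-identityʳ (weight G S))))))
  traverse fuel (u ∷ l) {S = S} tr enough pend vis with u ∈? S
  ... | yes u∈ = skipVisited u∈ vis thenReaches λ { (vis′ , refl) →
    reweaken (traverse fuel l tr enough (pending-drop pend id u∈) vis′) λ { {t} (traversed {S₂} trace grows visited cost) →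
      traversed trace grows visited (skip-cost {t} {W = weight G S} {weight G S₂} {length l} cost) } }
  ... | no u∉ = visit u∉ vis thenReaches λ { (vis′ , refl) → traverse-unvisited fuel l u∉ tr enough pend vis′ }

  traverse-unvisited 0 l {S = S} u∉ tr enough pend vis =
    ⊥-elim (ℕ.<⇒≱ (visited-length vis) (subst (n ≤_) (ℕ.+-identityʳ (length S)) enough))
  traverse-unvisited (suc fuel) l {S = S} {u = u} u∉ tr enough pend vis =
    traverse fuel (row-of u) (explore-traversal u) enough′ (pending-row u) vis
      thenReaches λ { {t₁} (traversed {S₁} trace₁ grows₁ vis₁ cost₁) →
    pop vis₁ thenReaches λ { (vis₂ , refl) →
    reweaken (traverse fuel l tr (ℕ.≤-trans enough′ (ℕ.+-monoˡ-≤ fuel (unique-length (S! vis) grows₁)))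
               (pending-drop pend (grows₁ ∘ there) (grows₁ (here refl))) vis₂)
      λ { {t₂} (traversed {S₂} trace₂ grows₂ vis₃ cost₂) →
        traversed (next tr ((sound pend (here refl) , u∉) , λ w (p , w∉) → pending-largest pend w p w∉) trace₁ trace₂)
          (grows₂ ∘ grows₁ ∘ there) vis₃
          (visit-cost {t₁} {t₂} {degree u} {W = weight G S} {weight G S₁} {weight G S₂} {length l}
            (row-length u) cost₁ cost₂) } } }
    where
    enough′ : n ≤ suc (length S) + fuel
    enough′ = subst (n ≤_) (ℕ.+-suc (length S) fuel) enough

length-≡ : ∀ {n} {D : List (Fin n)} → Unique D → (∀ v → v ∈ D) → length D ≡ n
length-≡ {n} D! full = trans (↭-length (unique-↭ D! (Unique.allFin⁺ n) (λ _ → ∈-allFin _) (λ _ → full _)))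
  (List.length-tabulate {n = n} id)

module _ {n} (G : Graph n) where
  open Graph G

  weight-≤ : ∀ {D} → Unique D → (∀ v → v ∈ D) → weight G D ≤ 2 * (n + edgeCount)
  weight-≤ D! full = ℕ.≤-trans
    (ℕ.≤-reflexive (weight-↭ G (unique-↭ D! (Unique.allFin⁺ n) (λ _ → ∈-allFin _) (λ _ → full _))))
    (weight-allFin G)

-- Correctness and running time of the maxDFS program

module _ {Returns : ℕ → Value → Set} {n} {G : Graph n} (L : AdjacencyLists G) where
  open Graph G

  run-searchLoop : ∀ {σ D} → Unique D → (∀ v → v ∈ D) → Decreasing G D →
    reg σ 4 ≡ cons (encode D) nil → reg σ 13 ≡ nil → (∀ k → arr σ 3 k ≡ nil) → NeighboursIn G D σ →
    Run Returns searchLoop σ (λ t σ′ → ∃[ S ]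
      (reg σ′ 13 ≡ encode S × Search G [] S × Unique S × (∀ v → v ∈ S) × t ≤ 8 * (weight G S + length D) + 4))
  run-searchLoop {σ} {D} D! full sorted stack≡ out≡ empty nbs
    with reaches {T} ext (traversed {S} trace _ vis cost) ← traverse G D D! full sorted n D
           (search-traversal G D D! full sorted) ℕ.≤-refl
           (record { covers = λ w _ → inj₂ (full w) ; sound = λ _ → tt ; order = sorted })
           (record { stack≡ = stack≡ ; out≡ = out≡ ; seen = λ _ () ; unseen = λ w _ → cong toNum (empty (toℕ w))
                   ; lists = nbs ; S! = [] })
    -- Only the exhausted bottom list is left. Its pop takes 3 steps and the exit 1, which gives the
    -- `+ 4`.
    with reaches ext′ (vis′ , refl) ← pop {Returns} G D D! full sorted vis =
    run (ext (ext′ (exit (cong isCons (Visited.stack≡ vis′)))))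
      (S , Visited.out≡ vis′ , trace , Visited.S! vis′ , proj₂ (search-greedy G trace tt) ,
       ℕ.+-monoˡ-≤ 4 (subst (_≤ 8 * (weight G S + length D)) (ℕ.+-identityʳ T) cost))

  run-maxDFS : Run Returns maxDFS (input L) (λ t σ′ → ∃[ order ]
    (reg σ′ 1 ≡ encode order × MaxDFSOrder G order × t ≤ 62 * (1 + n + edgeCount)))
  run-maxDFS =
    run-vertices refl refl andThen λ { u₁ (vs , vs≡ , vs-sorted , vs-full , refl) →
    let U! = unique-reverse (AllPairs.map (λ k<k′ k≡k′ → ℕ.<-irrefl (cong toℕ k≡k′) k<k′) vs-sorted)
        U-full = λ v → ∈-resp-↭ (↭-sym (↭-reverse vs)) (vs-full v)
        D = byDegree G (reverse vs) (reverse vs)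
        D-full = byDegree-full G U! U-full U-full
        D! , D-sorted = byDegree-sorted G U! U-full (allPairs-reverse vs-sorted)
    in
    run-fillBuckets L vs (λ v → trans (arrs u₁ 0 (toℕ v)) (input-lists L v)) vs≡ (arrs u₁ 1)
      andThen λ {t₂} {σ₂} u₂ (filled , t₂≤) →
    run-sortLists L (reverse vs) vs (λ v → trans (arrs u₂ 0 (toℕ v)) (trans (arrs u₁ 0 (toℕ v)) (input-lists L v)))
      (trans (regs u₂ 3) vs≡) filled (trans (regs u₂ 9) (regs u₁ 9)) (λ k → trans (arrs u₂ 2 k) (arrs u₁ 2 k))
      andThen λ {t₃} {σ₃} u₃ (D≡ , nbs , t₃≤) →
    assign⨾ (cong (λ l → cons l nil) D≡)
    (run-searchLoop D! D-full D-sorted refl (trans (regs u₃ 13) (trans (regs u₂ 13) (regs u₁ 13)))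
      (λ k → trans (arrs u₃ 3 k) (trans (arrs u₂ 3 k) (arrs u₁ 3 k))) nbs
      andThen λ {t₄} {σ₄} u₄ (S , S≡ , trace , S! , S-full , t₄≤) →
    weaken (run-forEach (λ done τ σ′ → reg σ′ 1 ≡ encode done × τ ≡ 1 + 4 * length done) S
        (λ done _ _ v _ _ _ (r≡ , τ≡) → run-assign (cong (cons _) r≡)
          (refl , trans (cong (_+ 4) τ≡) (tick (length done))))
        S≡ (trans (regs u₄ 1) (trans (regs u₃ 1) (trans (regs u₂ 1) (regs u₁ 1))) , refl))
      λ { _ (r≡ , refl) → reverse S , r≡ , subst (Search G []) (sym (List.reverse-involutive S)) trace ,
          total t₂≤ t₃≤ t₄≤ (weight-≤ G U! U-full) (weight-≤ G D! D-full) (weight-≤ G S! S-full)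
            (length-≡ U! U-full) (length-≡ D! D-full)
            (trans (List.length-reverse S) (length-≡ S! S-full)) }) }
    where
    tick : ∀ k → 1 + 4 * k + 4 ≡ 1 + 4 * suc k
    tick = solve-∀
    -- 62 is the coefficient of n: 3 for listing the vertices, 14 for the buckets, 5 + 12 for
    -- sorting, 16 + 8 for the search loop and 4 for the final reversal.
    total : ∀ {t₂ t₃ t₄ wU wD wS lU lD lS} →
      t₂ ≤ 2 + 7 * wU → t₃ ≤ 2 + 5 * lU + 6 * wD → t₄ ≤ 8 * (wS + lD) + 4 →
      wU ≤ 2 * (n + edgeCount) → wD ≤ 2 * (n + edgeCount) → wS ≤ 2 * (n + edgeCount) →
      lU ≡ n → lD ≡ n → lS ≡ n →
      2 + 3 * n + (t₂ + (t₃ + suc (t₄ + (1 + 4 * lS)))) ≤ 62 * (1 + n + edgeCount)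
    total {t₂} {t₃} {t₄} t₂≤ t₃≤ t₄≤ wU≤ wD≤ wS≤ refl refl refl = begin
      2 + 3 * n + (t₂ + (t₃ + suc (t₄ + (1 + 4 * n))))
        ≤⟨ ℕ.+-monoʳ-≤ (2 + 3 * n) (ℕ.+-mono-≤ (ℕ.≤-trans t₂≤ (ℕ.+-monoʳ-≤ 2 (ℕ.*-monoʳ-≤ 7 wU≤)))
             (ℕ.+-mono-≤ (ℕ.≤-trans t₃≤ (ℕ.+-monoʳ-≤ (2 + 5 * n) (ℕ.*-monoʳ-≤ 6 wD≤)))
               (s≤s (ℕ.+-monoˡ-≤ (1 + 4 * n) (ℕ.≤-trans t₄≤ (ℕ.+-monoˡ-≤ 4 (ℕ.*-monoʳ-≤ 8 (ℕ.+-monoˡ-≤ n wS≤)))))))) ⟩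
      2 + 3 * n + (2 + 7 * (2 * (n + edgeCount)) + (2 + 5 * n + 6 * (2 * (n + edgeCount)) +
        suc (8 * (2 * (n + edgeCount) + n) + 4 + (1 + 4 * n))))
        ≤⟨ slack (50 + 20 * edgeCount) (arithmetic n edgeCount) ⟩
      62 * (1 + n + edgeCount) ∎
      where
      open ℕ.≤-Reasoning
      arithmetic : ∀ n m → 2 + 3 * n + (2 + 7 * (2 * (n + m)) + (2 + 5 * n + 6 * (2 * (n + m)) +
        suc (8 * (2 * (n + m) + n) + 4 + (1 + 4 * n)))) + (50 + 20 * m) ≡ 62 * (1 + n + m)
      arithmetic = solve-∀

-- The recognition program.  When v is examined, array 2 holds its visited
-- neighbours, latest first; array 4 keeps that list, since later pushes extend
-- the one in array 2, and array 1 the position of v.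

-- The `pair?` guards are essential: the head of an empty list is `nil`, which `==` would confuse
-- with vertex 0.
stripTest : Test
stripTest = ((pair? (var 9)) && (pair? (var 11))) && ((fst (var 9)) == (fst (var 11)))

stripCommon : Program
stripCommon = while stripTest loop (9 := snd (var 9) ⨾ 11 := snd (var 11))

readsLater : Test
readsLater = (pair? (var 9)) && (! ((pair? (var 11)) && ((1 [ fst (var 9) ]) << (1 [ fst (var 11) ]))))

reportEdge : Expr → Expr → Program
reportEdge a b = 13 := a ⨾ 14 := b ⨾ 3 := lit 1

verdict : Program
verdict =
  if readsLater then reportEdge (var 8) (var 5)
  else (if pair? (var 11) then reportEdge (fst (var 11)) (var 8) else skip)

compare : Program
compare =
  8 := fst (var 12) ⨾
  9 := snd (var 12) ⨾
  11 := 4 [ var 8 ] ⨾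
  stripCommon ⨾
  verdict

checkParent : Program
checkParent = if pair? (var 12) then compare else skip

-- Register 3 is set once an edge with incomparable neighbourhoods has been
-- found; its ends are then in registers 13 and 14.
examine : Program
examine =
  if (var 3) == (lit 0) then (
    12 := 2 [ var 5 ] ⨾
    checkParent ⨾
    4 [ var 5 ]:= var 12 ⨾
    1 [ var 5 ]:= var 4 ⨾
    4 := succ (var 4) ⨾
    pushToNeighbours)
  else skip

mark : ℕ → Program
mark k = 6 [ var 7 ]:= lit k

-- There is no test for the end of the list: a private neighbour exists whenever this runs, and the
-- loop stops there at the latest.
skipMarked : ℕ → Program
skipMarked k = while (6 [ fst (var 6) ]) == (lit k) loop (6 := snd (var 6))

-- Marks the closed neighbourhood of the vertex in register 17 with k and leaves
-- register 6 at the first unmarked neighbour of the vertex in register 18.  Two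
-- searches with different k share array 6, which is never cleared.
findPrivate : ℕ → Program
findPrivate k =
  6 [ var 17 ]:= lit k ⨾
  6 := 0 [ var 17 ] ⨾
  forEach 6 7 (mark k) ⨾
  6 := 0 [ var 18 ] ⨾
  skipMarked k

refute : Program
refute =
  17 := var 14 ⨾
  18 := var 13 ⨾
  findPrivate 1 ⨾
  15 := fst (var 6) ⨾
  17 := var 13 ⨾
  18 := var 14 ⨾
  findPrivate 2 ⨾
  1 := pair (lit 0) (pair (var 15) (pair (var 13) (pair (var 14) (pair (fst (var 6)) nil))))

conclude : Program
conclude = if (var 3) == (lit 0) then (1 := pair (lit 1) (var 10)) else refute

afterSearch : Program
afterSearch =
  2 := var 10 ⨾
  forEach 2 5 examine ⨾
  conclude

recognize : Program
recognize = 10 :=search ⨾ afterSearch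

≡ᵇ-refl : ∀ m → (m ≡ᵇ m) ≡ true
≡ᵇ-refl 0       = refl
≡ᵇ-refl (suc m) = ≡ᵇ-refl m

≢⇒≡ᵇ : ∀ {m k} → m ≢ k → (m ≡ᵇ k) ≡ false
≢⇒≡ᵇ {m} {k} m≢k with m ≡ᵇ k | ℕ.≡ᵇ⇒≡ m k
... | true  | eq = ⊥-elim (m≢k (eq tt))
... | false | _  = refl

position-injective : ∀ {n} {D : List (Fin n)} {u v} → Unique D → u ∈ D → v ∈ D →
                     position D u ≡ position D v → u ≡ v
position-injective _ (here refl) (here refl) _ = refl
position-injective {D = x ∷ D} (x∉ ∷ _) (here refl) (there v∈) eq = ⊥-elim (ℕ.<-irrefl
  (trans (sym (cong length (before-there D (∈-≢ x∉ v∈)))) (trans (sym eq) (cong length (before-here x D))))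
  (position<length D _ v∈))
position-injective {D = x ∷ D} (x∉ ∷ _) (there u∈) (here refl) eq = ⊥-elim (ℕ.<-irrefl
  (trans (sym (cong length (before-there D (∈-≢ x∉ u∈)))) (trans eq (cong length (before-here x D))))
  (position<length D _ u∈))
position-injective {D = x ∷ D} (x∉ ∷ D!) (there u∈) (there v∈) eq = position-injective D! u∈ v∈
  (trans (sym (cong length (before-there D (∈-≢ x∉ u∈)))) (trans eq (cong length (before-there D (∈-≢ x∉ v∈)))))

-- What the first difference of E(v) and E(p) proves

module _ {n} (G : Graph n) where
  open Graph G

  Crossing : Fin n → Fin n → Set
  Crossing a b = a ∼ b × ¬ (∀ x → ¬ Private G a b x) × ¬ (∀ y → ¬ Private G b a y)

  module _ {D v p r₀ com r s} (g : Greedy G D) (v∉ : v ∉ D)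
           (v≡ : filter (v ∼?_) D ≡ p ∷ r₀) (r≡ : r₀ ≡ com ++ r) (s≡ : earlier G D p ≡ com ++ s) where
    private
      D! : Unique D
      D! = greedy⇒unique G D g
      p∈ : p ∈ D × v ∼ p
      p∈ = ∈-filter⁻ (v ∼?_) (subst (p ∈_) (sym v≡) (here refl))
      B = before D p
      v∼B : filter (v ∼?_) B ≡ com ++ r
      v∼B = trans (sym (filter-tail (v ∼?_) D! v≡)) r≡
      B-sorted : AllPairs (λ x y → position D y < position D x) B
      B-sorted = allPairs-before p (position-decreasing D!)
      from-r : ∀ {x} → x ∈ r → x ∈ B × v ∼ x
      from-r {x} x∈ = ∈-filter⁻ (v ∼?_) (subst (x ∈_) (sym v∼B) (∈-++⁺ʳ com x∈))
      from-s : ∀ {z} → z ∈ s → z ∈ B × p ∼ z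
      from-s {z} z∈ = ∈-filter⁻ (p ∼?_) (subst (z ∈_) (sym s≡) (∈-++⁺ʳ com z∈))

    mismatch∈ : ∀ {x} → x ∈ r ⊎ x ∈ s → x ∈ D
    mismatch∈ (inj₁ x∈) = before⊆ D (proj₁ (from-r x∈))
    mismatch∈ (inj₂ x∈) = before⊆ D (proj₁ (from-s x∈))

    -- x is a neighbour of v missed by p, hence private to v, the later end of the edge pv.
    crossing-parent : ∀ {x r′} → r ≡ x ∷ r′ → (∀ {z s′} → s ≡ z ∷ s′ → position D z < position D x) → Crossing p v
    crossing-parent {x} refl s< =
      symm (proj₂ p∈) , greedy-crossing G g (proj₁ p∈) v∉ (symm (proj₂ p∈)) priv , λ none → none x priv
      where
      priv : Private G v p x
      priv = symm (proj₂ (from-r (here refl))) ,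
             (λ x∼p → ∉-filter-head (v ∼?_) (p ∼?_) (position D) com B-sorted v∼B s≡ s< (symm x∼p)) ,
             λ { refl → ∉-before D! (proj₁ (from-r (here refl))) }

    -- Now p is the later end, with v as its private neighbour. The greedy argument is moved back to
    -- the time when p was visited, so `before D p` takes the place of D.
    crossing-grandparent : ∀ {z s′} → s ≡ z ∷ s′ → (∀ {x r′} → r ≡ x ∷ r′ → position D x < position D z) → Crossing z p
    crossing-grandparent {z} refl r< = symm (proj₂ z∈) ,
      greedy-crossing G (greedy-before G p g) (proj₁ z∈) (∉-before D!) (symm (proj₂ z∈)) priv , λ none → none v priv
      where
      z∈ : z ∈ B × p ∼ z
      z∈ = from-s (here refl)
      priv : Private G p z v
      priv = proj₂ p∈ ,
             ∉-filter-head (p ∼?_) (v ∼?_) (position D) com B-sorted s≡ v∼B r< ,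
             λ { refl → v∉ (before⊆ D (proj₁ z∈)) }

-- Examining the vertices in search order

module _ {n} (G : Graph n) where
  open Graph G

  -- The state between two examinations as long as no crossing edge has been found. The counter is
  -- the position of the next vertex; it is read through `toNum` because register 4 starts as `nil`.
  record Consistent (D : List (Fin n)) (σ : State) : Set where
    field
      accepting : toNum (reg σ 3) ≡ 0
      counter   : toNum (reg σ 4) ≡ length D
      lists     : NeighboursIn G D σ
      snapshots : ∀ w → w ∈ D → arr σ 4 (toℕ w) ≡ encode (earlier G D w)
      positions : ∀ w → w ∈ D → toNum (arr σ 1 (toℕ w)) ≡ position D w
      nested    : Nested G D
  open Consistent

  record Rejected (σ : State) : Set where
    field
      {a b}    : Fin n
      flagged  : toNum (reg σ 3) ≡ 1
      first≡   : reg σ 13 ≡ num (toℕ a)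
      second≡  : reg σ 14 ≡ num (toℕ b)
      crossing : Crossing G a b
  open Rejected

  Verdict : Fin n → List (Fin n) → State → Set
  Verdict v D σ = (toNum (reg σ 3) ≡ 0 × Nested G (v ∷ D)) ⊎ Rejected σ

private
  -- The test as a function of the register contents, so that equations about registers can be
  -- applied by congruence.
  test-strip : Value → Value → Bool
  test-strip r s = (isCons r ∧ isCons s) ∧ (toNum (first r) ≡ᵇ toNum (first s))

module _ {n : ℕ} where

  record Stripped (r₀ s₀ : List (Fin n)) (σ : State) : Set where
    field
      {com r s} : List (Fin n)
      r₀≡       : r₀ ≡ com ++ r
      s₀≡       : s₀ ≡ com ++ s
      r≡        : reg σ 9 ≡ encode r
      s≡        : reg σ 11 ≡ encode s
      apart     : ∀ {x r′ z s′} → r ≡ x ∷ r′ → s ≡ z ∷ s′ → x ≢ z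

prepend : ∀ {n} (x : Fin n) {r₀ s₀ σ} → Stripped r₀ s₀ σ → Stripped (x ∷ r₀) (x ∷ s₀) σ
prepend x st = record
  { Stripped st ; com = x ∷ Stripped.com st
  ; r₀≡ = cong (x ∷_) (Stripped.r₀≡ st) ; s₀≡ = cong (x ∷_) (Stripped.s₀≡ st) }

module _ {Returns : ℕ → Value → Set} {n : ℕ} where

  -- Every round consumes an entry of r₀, which is charged to v. The length of s₀ could not be
  -- charged to its owner p, since one parent may be compared with many children.
  run-stripCommon : ∀ {σ} (r₀ s₀ : List (Fin n)) → reg σ 9 ≡ encode r₀ → reg σ 11 ≡ encode s₀ →
    Run Returns stripCommon σ (λ t σ′ → Stripped r₀ s₀ σ′ × t ≤ 1 + 3 * length r₀)
  run-stripCommon [] s₀ r≡ s≡ =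
    run-exit (cong₂ test-strip r≡ s≡)
      (record { com = [] ; r₀≡ = refl ; s₀≡ = refl ; r≡ = r≡ ; s≡ = s≡ ; apart = λ () } , s≤s z≤n)
  run-stripCommon (x ∷ r₀) [] r≡ s≡ =
    run-exit (cong₂ test-strip r≡ s≡)
      (record { com = [] ; r₀≡ = refl ; s₀≡ = refl ; r≡ = r≡ ; s≡ = s≡ ; apart = λ _ () } , s≤s z≤n)
  run-stripCommon (x ∷ r₀) (z ∷ s₀) r≡ s≡ with x Fin.≟ z
  ... | no x≢z = run-exit (trans (cong₂ test-strip r≡ s≡) (≢⇒≡ᵇ (x≢z ∘ Fin.toℕ-injective)))
      (record { com = [] ; r₀≡ = refl ; s₀≡ = refl ; r≡ = r≡ ; s≡ = s≡ ; apart = λ { refl refl → x≢z } } , s≤s z≤n)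
  ... | yes refl =
    run-repeat {P = λ t σ′ → reg σ′ 9 ≡ encode r₀ × reg σ′ 11 ≡ encode s₀ × t ≡ 2}
      (trans (cong₂ test-strip r≡ s≡) (≡ᵇ-refl (toℕ x)))
      (assign⨾ (cong second r≡) (run-assign (cong second s≡) (refl , refl , refl)))
      λ { _ (r≡′ , s≡′ , refl) → weaken (run-stripCommon r₀ s₀ r≡′ s≡′) λ _ (st , t≤) →
        prepend x st ,
        ℕ.≤-trans (ℕ.+-monoʳ-≤ 3 t≤) (ℕ.≤-reflexive (tick (length r₀))) }
    where
    tick : ∀ k → 3 + (1 + 3 * k) ≡ 1 + 3 * suc k
    tick = solve-∀

private
  test-later : Value → Value → (ℕ → Value) → Bool
  test-later r s pos = isCons r ∧ not (isCons s ∧ (toNum (pos (toNum (first r))) <ᵇ toNum (pos (toNum (first s)))))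

  <ᵇ-true : ∀ {m k} → m < k → (m <ᵇ k) ≡ true
  <ᵇ-true {m} {k} m<k with m <ᵇ k | ℕ.<⇒<ᵇ m<k
  ... | true | _ = refl

  <ᵇ-false : ∀ {m k} → ¬ m < k → (m <ᵇ k) ≡ false
  <ᵇ-false {m} {k} m≮k with m <ᵇ k | ℕ.<ᵇ⇒< m k
  ... | true  | lt = ⊥-elim (m≮k (lt tt))
  ... | false | _  = refl

module _ {Returns : ℕ → Value → Set} {n} (G : Graph n) where
  open Graph G
  open Rejected

  run-reportEdge : ∀ {σ ea eb a b} → eval σ ea ≡ num (toℕ a) →
    eval (setReg 13 (num (toℕ a)) σ) eb ≡ num (toℕ b) → Crossing G a b →
    Run Returns (reportEdge ea eb) σ (λ t σ′ → Rejected G σ′ × t ≡ 3)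
  run-reportEdge a≡ b≡ cross = assign⨾ a≡ (assign⨾ b≡ (run-assign refl
    (record { flagged = refl ; first≡ = refl ; second≡ = refl ; crossing = cross } , refl)))

  run-verdict : ∀ {σ D v p r₀} → Greedy G D → v ∉ D → filter (v ∼?_) D ≡ p ∷ r₀ → Nested G D →
    reg σ 5 ≡ num (toℕ v) → reg σ 8 ≡ num (toℕ p) → toNum (reg σ 3) ≡ 0 →
    (∀ w → w ∈ D → toNum (arr σ 1 (toℕ w)) ≡ position D w) → Stripped r₀ (earlier G D p) σ →
    Run Returns verdict σ (λ t σ′ → Verdict G v D σ′ × t ≤ 5)
  run-verdict {σ} {D} {v} {p} {r₀} g v∉ v≡ nest v-reg p-reg flag pos
    record { com = com ; r = r ; s = s ; r₀≡ = r₀≡ ; s₀≡ = s₀≡ ; r≡ = r≡ ; s≡ = s≡ ; apart = apart } = cases r s refl refl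
    where
    at-test : ∀ {e} → test-later (encode r) (encode s) (arr σ 1) ≡ e → test σ readsLater ≡ e
    at-test = trans (cong₂ (λ r s → test-later r s (arr σ 1)) r≡ s≡)
    parent-wrong : ∀ {x r′} → r ≡ x ∷ r′ → (∀ {z s′} → s ≡ z ∷ s′ → position D z < position D x) →
      test σ readsLater ≡ true → Run Returns verdict σ (λ t σ′ → Verdict G v D σ′ × t ≤ 5)
    parent-wrong eq s< te = run-true te (weaken
      (run-reportEdge p-reg v-reg (crossing-parent G g v∉ v≡ r₀≡ s₀≡ eq s<))
      λ { _ (rej , refl) → inj₂ rej , ℕ.≤ᵇ⇒≤ 4 5 tt })
    grandparent-wrong : ∀ {z s′} → s ≡ z ∷ s′ → (∀ {x r′} → r ≡ x ∷ r′ → position D x < position D z) →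
      test σ readsLater ≡ false → Run Returns verdict σ (λ t σ′ → Verdict G v D σ′ × t ≤ 5)
    grandparent-wrong refl r< te = run-false te (run-true (cong isCons s≡) (weaken
      (run-reportEdge (cong first s≡) p-reg (crossing-grandparent G g v∉ v≡ r₀≡ s₀≡ refl r<))
      λ { _ (rej , refl) → inj₂ rej , ℕ.≤-refl }))
    cases : ∀ r′ s′ → r ≡ r′ → s ≡ s′ → Run Returns verdict σ (λ t σ′ → Verdict G v D σ′ × t ≤ 5)
    cases [] [] refl refl = run-false (at-test refl) (run-false (cong isCons s≡) (run-skip
      (inj₁ (flag , child p nest (trans v≡ (cong (p ∷_) (trans r₀≡ (sym s₀≡))))) , ℕ.≤ᵇ⇒≤ 3 5 tt)))
    cases (x ∷ r′) [] refl refl = parent-wrong refl (λ ()) (at-test refl)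
    cases [] (z ∷ s′) refl refl = grandparent-wrong refl (λ ()) (at-test refl)
    cases (x ∷ r′) (z ∷ s′) refl refl with ℕ.<-cmp (position D x) (position D z)
    ... | tri< x<z _ _ = grandparent-wrong refl (λ { refl → x<z })
          (at-test (cong not (<ᵇ-true (subst₂ _<_ (sym (pos x x∈)) (sym (pos z z∈)) x<z))))
      where
      x∈ : x ∈ D
      x∈ = mismatch∈ G g v∉ v≡ r₀≡ s₀≡ (inj₁ (here refl))
      z∈ : z ∈ D
      z∈ = mismatch∈ G g v∉ v≡ r₀≡ s₀≡ (inj₂ (here refl))
    -- Equal positions would mean equal vertices, which `stripCommon` has removed.
    ... | tri≈ _ x≡z _ = ⊥-elim (apart refl refl (position-injective (greedy⇒unique G D g)
          (mismatch∈ G g v∉ v≡ r₀≡ s₀≡ (inj₁ (here refl))) (mismatch∈ G g v∉ v≡ r₀≡ s₀≡ (inj₂ (here refl))) x≡z))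
    ... | tri> x≮z _ z<x = parent-wrong refl (λ { refl → z<x })
          (at-test (cong not (<ᵇ-false (λ x<z → x≮z (subst₂ _<_ (pos x x∈) (pos z z∈) x<z)))))
      where
      x∈ : x ∈ D
      x∈ = mismatch∈ G g v∉ v≡ r₀≡ s₀≡ (inj₁ (here refl))
      z∈ : z ∈ D
      z∈ = mismatch∈ G g v∉ v≡ r₀≡ s₀≡ (inj₂ (here refl))

module _ {n} (G : Graph n) where
  open Graph G

  filter-length : ∀ {D} v → Unique D → length (filter (v ∼?_) D) ≤ degree v
  filter-length {D} v D! = unique-length (Unique.filter⁺ (v ∼?_) D!)
    (λ w∈ → ∈-filter⁺ (v ∼?_) (∈-allFin _) (proj₂ (∈-filter⁻ (v ∼?_) {xs = D} w∈)))

  -- Examining a vertex of degree d takes at most 20 + 7 d steps: 10 + 3 d for the parent check, 2 +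
  -- 4 d for the pushes and 8 for the rest.
  Progress : List (Fin n) → ℕ → State → Set
  Progress D τ σ = τ ≤ 1 + 20 * weight G D × (Consistent G D σ ⊎ Rejected G σ)

module _ {Returns : ℕ → Value → Set} {n} {G : Graph n} (L : AdjacencyLists G) where
  open Graph G
  open AdjacencyLists L
  open Consistent
  open Rejected

  run-checkParent : ∀ {σ D v} → Greedy G D → v ∉ D → Consistent G D σ → reg σ 5 ≡ num (toℕ v) →
    reg σ 12 ≡ encode (filter (v ∼?_) D) →
    Run Returns checkParent σ (λ t σ′ → Verdict G v D σ′ × t ≤ 10 + 3 * degree v)
  run-checkParent {σ} {D} {v} g v∉ con v≡ l≡ = cases _ refl
    where
    cases : ∀ l → filter (v ∼?_) D ≡ l →
      Run Returns checkParent σ (λ t σ′ → Verdict G v D σ′ × t ≤ 10 + 3 * degree v)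
    cases [] eq = run-false (trans (cong isCons l≡) (cong (isCons ∘ encode) eq))
      (run-skip (inj₁ (accepting con , root (nested con) eq) , s≤s (s≤s z≤n)))
    cases (p ∷ r₀) eq = run-true (cong isCons l≡′)
      (assign⨾ (cong first l≡′) (assign⨾ (cong second l≡′) (assign⨾ (snapshots con p p∈)
        (run-stripCommon r₀ (earlier G D p) refl refl andThen λ u (st , t≤) →
          weaken (run-verdict G g v∉ eq (nested con) (trans (regs u 5) v≡) (regs u 8)
                    (trans (cong toNum (regs u 3)) (accepting con))
                    (λ w w∈ → trans (cong toNum (arrs u 1 (toℕ w))) (positions con w w∈)) st)
            λ _ (ver , t′≤) → ver , time t≤ t′≤))))
      where
      l≡′ : reg σ 12 ≡ encode (p ∷ r₀)
      l≡′ = trans l≡ (cong encode eq)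
      p∈ : p ∈ D
      p∈ = proj₁ (∈-filter⁻ (v ∼?_) (subst (p ∈_) (sym eq) (here refl)))
      sum≡ : ∀ r → 4 + (1 + 3 * r + 5) ≡ 10 + 3 * r
      sum≡ = solve-∀
      time : ∀ {t t′} → t ≤ 1 + 3 * length r₀ → t′ ≤ 5 → 4 + (t + t′) ≤ 10 + 3 * degree v
      time t≤ t′≤ = ℕ.≤-trans (ℕ.+-monoʳ-≤ 4 (ℕ.+-mono-≤ t≤ t′≤)) (ℕ.≤-trans (ℕ.≤-reflexive (sum≡ (length r₀)))
        (ℕ.+-monoʳ-≤ 10 (ℕ.*-monoʳ-≤ 3 (ℕ.≤-trans (ℕ.n≤1+n _)
          (subst (λ l → length l ≤ degree v) eq (filter-length G v (greedy⇒unique G D g)))))))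

  run-examine : ∀ {order σ} → Greedy G (reverse order) → HasLists L σ →
    Iteration {Returns} 2 5 examine order (Progress G) σ
  run-examine greedy lists₀ D τ σ v rest whole same (τ≤ , inj₂ rej) =
    run-false (cong (_≡ᵇ 0) (flagged rej)) (run-skip
      (ℕ.≤-trans (ℕ.+-monoˡ-≤ 5 τ≤) (slack (15 + 20 * degree v) (bound (weight G D) (degree v))) ,
       inj₂ (record { flagged = flagged rej ; first≡ = first≡ rej ; second≡ = second≡ rej ; crossing = crossing rej })))
    where
    bound : ∀ w d → 1 + 20 * w + 5 + (15 + 20 * d) ≡ 1 + 20 * (suc d + w)
    bound = solve-∀
  run-examine {order} greedy lists₀ D τ σ v rest whole same (τ≤ , inj₁ con) =
    run-true (cong (_≡ᵇ 0) (accepting con))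
      (assign⨾ (lists con v)
        -- The invariant reads only registers 3 and 4 and arrays, so after the assignments to
        -- registers 2, 5 and 12 it holds by computation.
        (run-checkParent {v = v} g v∉ (record { Consistent con }) refl refl andThen λ {t₁} {σ₁} u₁ (ver , t₁≤) →
      store⨾ (cong toNum (regs u₁ 5)) (regs u₁ 12)
        (store⨾ (cong toNum (regs u₁ 5)) refl
          (assign⨾ refl
            (weaken (run-pushToNeighbours L v
                      (λ w → trans (arrs u₁ 0 (toℕ w)) (trans (arrs same 0 (toℕ w)) (lists₀ w)))
                      (regs u₁ 5) (λ w → trans (arrs u₁ 2 (toℕ w)) (lists con w)))
              λ { {_} {σ₃} u₃ (nbs , refl) → time t₁≤ , Sum.map
                (λ (flag , nest) → record
                  { accepting = trans (cong toNum (regs u₃ 3)) flag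
                  ; counter   = trans (cong toNum (regs u₃ 4)) (cong suc (trans (cong toNum (regs u₁ 4)) (counter con)))
                  ; lists     = nbs
                  ; snapshots = λ w w∈ → trans (arrs u₃ 4 (toℕ w)) (snapshot (arr σ₁ 4) (λ u → arrs u₁ 4 (toℕ u)) w w∈)
                  ; positions = λ w w∈ → trans (cong toNum (arrs u₃ 1 (toℕ w)))
                      (place (arr σ₁ 1) (λ u → arrs u₁ 1 (toℕ u)) (reg σ₁ 4)
                        (trans (cong toNum (regs u₁ 4)) (counter con)) w w∈)
                  ; nested    = nest })
                (λ rej → record
                  { flagged = trans (cong toNum (regs u₃ 3)) (flagged rej)
                  ; first≡ = trans (regs u₃ 13) (first≡ rej) ; second≡ = trans (regs u₃ 14) (second≡ rej)
                  ; crossing = crossing rej })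
                ver })))))
    where
    -- The vertices examined so far are a final segment of `reverse order`, so the trace of the
    -- whole search restricts to `v ∷ D`.
    reversed : reverse order ≡ rest ʳ++ v ∷ D
    reversed = trans (cong reverse (sym whole))
      (trans (List.ʳ++-ʳ++ D) (cong (λ E → (v ∷ rest) ʳ++ E) (List.++-identityʳ D)))
    chosen : Greedy G (v ∷ D)
    chosen = greedy-ʳ++⁻ G rest (subst (Greedy G) reversed greedy)
    g : Greedy G D
    g = proj₁ (proj₂ chosen)
    v∉ : v ∉ D
    v∉ = ∉-head (proj₁ chosen)
    snapshot : ∀ f → (∀ u → f (toℕ u) ≡ arr σ 4 (toℕ u)) → ∀ w → w ∈ v ∷ D →
      update f (toℕ v) (encode (filter (v ∼?_) D)) (toℕ w) ≡ encode (earlier G (v ∷ D) w)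
    snapshot f f≡ w (here refl) = trans (update-same f (toℕ v) _) (cong encode (sym (earlier-here G v D)))
    snapshot f f≡ w (there w∈)  = trans (array-other f (λ { refl → v∉ w∈ }))
      (trans (f≡ w) (trans (snapshots con w w∈) (cong encode (sym (earlier-there G (proj₁ chosen) w∈)))))
    place : ∀ f → (∀ u → f (toℕ u) ≡ arr σ 1 (toℕ u)) → ∀ x → toNum x ≡ length D → ∀ w → w ∈ v ∷ D →
      toNum (update f (toℕ v) x (toℕ w)) ≡ position (v ∷ D) w
    place f f≡ x x≡ w (here refl) = trans (cong toNum (update-same f (toℕ v) _))
      (trans x≡ (cong length (sym (before-here v D))))
    place f f≡ x x≡ w (there w∈)  = trans (cong toNum (trans (array-other f (λ { refl → v∉ w∈ })) (f≡ w)))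
      (trans (positions con w w∈) (cong length (sym (before-there D (λ { refl → v∉ w∈ })))))
    lhs : ∀ τ t d → τ + (3 + suc (suc (t + suc (suc (suc (2 + 4 * d)))))) ≡ 10 + 4 * d + (τ + t)
    lhs = solve-∀
    rhs : ∀ w d → 10 + 4 * d + (1 + 20 * w + (10 + 3 * d)) + 13 * d ≡ 1 + 20 * (suc d + w)
    rhs = solve-∀
    time : ∀ {t} → t ≤ 10 + 3 * degree v →
      τ + (3 + suc (suc (t + suc (suc (suc (2 + 4 * degree v)))))) ≤ 1 + 20 * weight G (v ∷ D)
    time {t} t≤ = ℕ.≤-trans (ℕ.≤-reflexive (lhs τ t (degree v)))
      (ℕ.≤-trans (ℕ.+-monoʳ-≤ (10 + 4 * degree v) (ℕ.+-mono-≤ τ≤ t≤)) (slack (13 * degree v) (rhs (weight G D) (degree v))))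

  -- Unmarked cells are only known to lie below k: they read as 0 in the first scan and may hold an
  -- old mark 1 in the second. If the head is marked it is not private, so a private neighbour
  -- remains in the tail.
  run-skipMarked : ∀ {k a b} l {σ} →
    (∀ w → w ≡ b ⊎ w ∼ b → toNum (arr σ 6 (toℕ w)) ≡ k) →
    (∀ w → w ≢ b → ¬ w ∼ b → toNum (arr σ 6 (toℕ w)) < k) →
    (∀ {x} → x ∈ l → x ∼ a) → ¬ (∀ x → x ∈ l → ¬ Private G a b x) → reg σ 6 ≡ encode l →
    Run Returns (skipMarked k) σ (λ t σ′ → ∃[ x ]
      (Private G a b x × first (reg σ′ 6) ≡ num (toℕ x) × t ≤ 1 + 2 * length l))
  run-skipMarked [] _ _ _ some _ = ⊥-elim (some (λ _ ()))
  run-skipMarked {k} {a} {b} (x ∷ l) {σ} hit miss l∼a some l≡ = cases (x Fin.≟ b) (x ∼? b)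
    where
    Post : ℕ → State → Set
    Post t σ′ = ∃[ x ] (Private G a b x × first (reg σ′ 6) ≡ num (toℕ x) × t ≤ 1 + 2 * length (x ∷ l))
    test≡ : test σ ((6 [ fst (var 6) ]) == (lit k)) ≡ (toNum (arr σ 6 (toℕ x)) ≡ᵇ k)
    test≡ = cong (λ r → toNum (arr σ 6 (toNum (first r))) ≡ᵇ k) l≡
    tick : ∀ m → 2 + (1 + 2 * m) ≡ 1 + 2 * suc m
    tick = solve-∀
    marked : x ≡ b ⊎ x ∼ b → ¬ Private G a b x → Run Returns (skipMarked k) σ Post
    marked x-marked ¬priv =
      run-repeat {P = λ t σ′ → reg σ′ 6 ≡ encode l × t ≡ 1}
        (trans test≡ (trans (cong (_≡ᵇ k) (hit x x-marked)) (≡ᵇ-refl k)))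
        (run-assign (cong second l≡) (refl , refl))
        λ { u (l≡′ , refl) → weaken
          (run-skipMarked l (λ w m → trans (cong toNum (arrs u 6 (toℕ w))) (hit w m))
            (λ w w≢b w≁b → subst (_< k) (cong toNum (sym (arrs u 6 (toℕ w)))) (miss w w≢b w≁b))
            (l∼a ∘ there) (λ none → some λ { _ (here refl) → ¬priv ; w (there w∈) → none w w∈ }) l≡′)
          λ _ (w , priv , w≡ , t≤) → w , priv , w≡ ,
            ℕ.≤-trans (ℕ.+-monoʳ-≤ 2 t≤) (ℕ.≤-reflexive (tick (length l))) }
    cases : Dec (x ≡ b) → Dec (x ∼ b) → Run Returns (skipMarked k) σ Post
    cases (yes x≡b) _         = marked (inj₁ x≡b) (λ (_ , _ , x≢b) → x≢b x≡b)
    cases (no _)    (yes x∼b) = marked (inj₂ x∼b) (λ (_ , x≁b , _) → x≁b x∼b)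
    cases (no x≢b)  (no x≁b)  = run-exit (trans test≡ (≢⇒≡ᵇ (ℕ.<⇒≢ (miss x x≢b x≁b))))
      (x , (l∼a (here refl) , x≁b , x≢b) , cong first l≡ , s≤s z≤n)

  -- Being called only twice, it may take time linear in n. All marks end up below `suc k`, as the
  -- next call, with `suc k`, expects.
  run-findPrivate : ∀ {σ} k {a b} → HasLists L σ → reg σ 17 ≡ num (toℕ b) → reg σ 18 ≡ num (toℕ a) →
    (∀ (w : Fin n) → toNum (arr σ 6 (toℕ w)) < k) → ¬ (∀ x → ¬ Private G a b x) →
    Run Returns (findPrivate k) σ (λ t σ′ → ∃[ x ] (Private G a b x × first (reg σ′ 6) ≡ num (toℕ x) ×
      (∀ (w : Fin n) → toNum (arr σ′ 6 (toℕ w)) < suc k) × t ≤ 5 + 6 * n))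
  run-findPrivate {σ} k {a} {b} lists₀ b≡ a≡ fresh some =
    store⨾ (cong toNum b≡) refl
      (assign⨾ (trans (cong (arr σ 0 ∘ toNum) b≡) (lists₀ b))
        (run-forEach Marking (neighbours b) step refl (refl , init)
          andThen λ { {_} {σ₂} u (refl , marking) →
        assign⨾ (trans (cong (arr σ₂ 0 ∘ toNum) (trans (regs u 18) a≡)) (trans (arrs u 0 (toℕ a)) (lists₀ a)))
          (weaken (run-skipMarked {k} (neighbours a)
              (λ w m → proj₁ (marking w) (Sum.map₂ to-done m))
              (λ w w≢b w≁b → proj₂ (marking w) w≢b (λ w∈ → w≁b (symm (Equivalence.to (complete b w) (∈-reverse w∈)))))
              (λ {x} x∈ → symm (Equivalence.to (complete a x) x∈))
              (λ none → some λ x priv → none x (Equivalence.from (complete a x) (symm (proj₁ priv))) priv)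
              refl)
            λ u′ (x , priv , x≡ , t≤) → x , priv , x≡ ,
              (λ w → subst (_< suc k) (cong toNum (sym (arrs u′ 6 (toℕ w)))) (marked≤ (marking w) (w Fin.≟ b) (w ∼? b))) ,
              time t≤) }))
    where
    Marking : List (Fin n) → ℕ → State → Set
    Marking done τ σ′ = τ ≡ 1 + 4 * length done × ∀ w →
      (w ≡ b ⊎ w ∈ done → toNum (arr σ′ 6 (toℕ w)) ≡ k) × (w ≢ b → w ∉ done → toNum (arr σ′ 6 (toℕ w)) < k)
    put : ∀ f {u} w → w ≡ u → toNum (update f (toℕ u) (num k) (toℕ w)) ≡ k
    put f w refl = cong toNum (update-same f (toℕ w) _)
    tick : ∀ m → 1 + 4 * m + 4 ≡ 1 + 4 * suc m
    tick = solve-∀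
    init : ∀ w → (w ≡ b ⊎ w ∈ [] → toNum (update (arr σ 6) (toℕ b) (num k) (toℕ w)) ≡ k) ×
                 (w ≢ b → w ∉ [] → toNum (update (arr σ 6) (toℕ b) (num k) (toℕ w)) < k)
    init w = (λ { (inj₁ w≡b) → put (arr σ 6) w w≡b ; (inj₂ ()) }) ,
             λ w≢b _ → subst (_< k) (cong toNum (sym (array-other (arr σ 6) w≢b))) (fresh w)
    step : Iteration {Returns} 6 7 (mark k) (neighbours b) Marking
             (setReg 6 (encode (neighbours b)) (setArr 6 (toℕ b) (num k) σ))
    step done _ σ′ u _ _ _ (refl , marking) = run-store refl refl (tick (length done) , λ w → hit w (w Fin.≟ u) ,
      λ w≢b w∉ → subst (_< k) (cong toNum (sym (array-other (arr σ′ 6) (w∉ ∘ here)))) (proj₂ (marking w) w≢b (w∉ ∘ there)))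
      where
      hit : ∀ w → Dec (w ≡ u) → w ≡ b ⊎ w ∈ u ∷ done → toNum (update (arr σ′ 6) (toℕ u) (num k) (toℕ w)) ≡ k
      hit w (yes w≡u) _ = put (arr σ′ 6) w w≡u
      hit w (no w≢u) m = trans (cong toNum (array-other (arr σ′ 6) w≢u)) (proj₁ (marking w) (Sum.map₂ earlier-done m))
        where
        earlier-done : w ∈ u ∷ done → w ∈ done
        earlier-done (here w≡u) = ⊥-elim (w≢u w≡u)
        earlier-done (there w∈) = w∈
    to-done : ∀ {w} → w ∼ b → w ∈ reverse (neighbours b)
    to-done {w} w∼b = ∈-resp-↭ (↭-sym (↭-reverse _)) (Equivalence.from (complete b w) (symm w∼b))
    marked≤ : ∀ {w x} → (w ≡ b ⊎ w ∈ reverse (neighbours b) → x ≡ k) × (w ≢ b → w ∉ reverse (neighbours b) → x < k) →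
      Dec (w ≡ b) → Dec (w ∼ b) → x < suc k
    marked≤ (hit , _) (yes w≡b) _ = s≤s (ℕ.≤-reflexive (hit (inj₁ w≡b)))
    marked≤ (hit , _) (no _) (yes w∼b) = s≤s (ℕ.≤-reflexive (hit (inj₂ (to-done w∼b))))
    marked≤ (_ , miss) (no w≢b) (no w≁b) =
      ℕ.m<n⇒m<1+n (miss w≢b (λ w∈ → w≁b (symm (Equivalence.to (complete b _) (∈-reverse w∈)))))
    degree≤n : ∀ v → length (neighbours v) ≤ n
    degree≤n v = subst (_≤ n) (sym (length-neighbours L v)) (ℕ.<⇒≤ (degree<n G v))
    sum≡ : ∀ m → suc (suc (1 + 4 * m + suc (1 + 2 * m))) ≡ 5 + 6 * m
    sum≡ = solve-∀
    time : ∀ {t} → t ≤ 1 + 2 * length (neighbours a) →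
      suc (suc (1 + 4 * length (reverse (neighbours b)) + suc t)) ≤ 5 + 6 * n
    time {t} t≤ = ℕ.≤-trans (s≤s (s≤s (ℕ.+-mono-≤
        (ℕ.+-monoʳ-≤ 1 (ℕ.*-monoʳ-≤ 4 (subst (_≤ n) (sym (List.length-reverse (neighbours b))) (degree≤n b))))
        (s≤s (ℕ.≤-trans t≤ (ℕ.+-monoʳ-≤ 1 (ℕ.*-monoʳ-≤ 2 (degree≤n a))))))))
      (ℕ.≤-reflexive (sum≡ n))

-- Certificates and total running time

module _ {Returns : ℕ → Value → Set} {n} {G : Graph n} (L : AdjacencyLists G) where
  open Graph G
  open Consistent
  open Rejected

  run-refute : ∀ {σ} → HasLists L σ → (∀ k → arr σ 6 k ≡ nil) → Rejected G σ →
    Run Returns refute σ (λ t σ′ → CorrectAnswer G (reg σ′ 1) × t ≤ 16 + 12 * n)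
  run-refute {σ} lists empty rej =
    assign⨾ (second≡ rej) (assign⨾ (first≡ rej)
      (run-findPrivate L 1 lists refl refl (λ w → s≤s (ℕ.≤-reflexive (cong toNum (empty (toℕ w))))) some-a
        andThen λ u₁ (x , x-priv , x≡ , fresh , t₁≤) →
      assign⨾ x≡ (assign⨾ (trans (regs u₁ 13) (first≡ rej)) (assign⨾ (trans (regs u₁ 14) (second≡ rej))
        (run-findPrivate L 2 (λ w → trans (arrs u₁ 0 (toℕ w)) (lists w)) refl refl fresh some-b
          andThen λ u₂ (y , y-priv , y≡ , _ , t₂≤) →
        run-assign
          (cong (cons (num 0)) (cong₂ cons (regs u₂ 15)
            (cong₂ cons (trans (regs u₂ 13) (trans (regs u₁ 13) (first≡ rej)))
              (cong₂ cons (trans (regs u₂ 14) (trans (regs u₁ 14) (second≡ rej)))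
                (cong (λ y → cons y nil) y≡)))))
          (crossing-answer G a∼b x-priv y-priv , time t₁≤ t₂≤))))))
    where
    a∼b = proj₁ (crossing rej)
    some-a = proj₁ (proj₂ (crossing rej))
    some-b = proj₂ (proj₂ (crossing rej))
    sum≡ : ∀ m → 5 + 6 * m + suc (suc (suc (5 + 6 * m + 1))) + 2 ≡ 16 + 12 * m
    sum≡ = solve-∀
    time : ∀ {t₁ t₂} → t₁ ≤ 5 + 6 * n → t₂ ≤ 5 + 6 * n → suc (suc (t₁ + suc (suc (suc (t₂ + 1))))) ≤ 16 + 12 * n
    time t₁≤ t₂≤ = ℕ.≤-trans (s≤s (s≤s (ℕ.+-mono-≤ t₁≤ (s≤s (s≤s (s≤s (ℕ.+-monoˡ-≤ 1 t₂≤)))))))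
      (ℕ.≤-trans (ℕ.≤-reflexive (ℕ.+-comm 2 _)) (ℕ.≤-reflexive (sum≡ n)))

  run-conclude : ∀ {σ order} → Greedy G (reverse order) → (∀ v → v ∈ reverse order) →
    HasLists L σ → (∀ k → arr σ 6 k ≡ nil) → reg σ 10 ≡ encode order →
    Consistent G (reverse order) σ ⊎ Rejected G σ →
    Run Returns conclude σ (λ t σ′ → CorrectAnswer G (reg σ′ 1) × t ≤ 17 + 12 * n)
  run-conclude {order = order} greedy full lists empty order≡ (inj₁ con) =
    run-true (cong (_≡ᵇ 0) (accepting con)) (run-assign (cong (cons (num 1)) order≡)
      (accept (nested⇒triviallyPerfect G (nested con) D! full) (nested⇒avoiding G {order} (nested con) D! full) ,
       s≤s (s≤s z≤n)))
    where
    D! = greedy⇒unique G (reverse order) greedy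
  run-conclude greedy full lists empty order≡ (inj₂ rej) =
    run-false (cong (_≡ᵇ 0) (flagged rej)) (weaken (run-refute lists empty rej) λ _ (ok , t≤) → ok , s≤s t≤)

  -- Any maxDFS order will do, whichever program produced it and however ties of degree were broken.
  -- The working arrays are still `nil` because the search has memory of its own.
  run-afterSearch : ∀ {σ order} → MaxDFSOrder G order → HasLists L σ →
    (∀ a → a ≢ 0 → ∀ k → arr σ a k ≡ nil) → reg σ 10 ≡ encode order → reg σ 3 ≡ nil → reg σ 4 ≡ nil →
    Run Returns afterSearch σ (λ t σ′ → CorrectAnswer G (reg σ′ 1) × t ≤ 72 * (1 + n + edgeCount))
  run-afterSearch {σ} {order} dfs lists empty order≡ flag≡ counter≡ =
    assign⨾ order≡
      (run-forEach (Progress G) order (run-examine L {order} greedy lists) refl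
         (s≤s z≤n , inj₁ (record
           { accepting = cong toNum flag≡ ; counter = cong toNum counter≡
           ; lists = λ w → empty 2 (λ ()) (toℕ w) ; snapshots = λ _ () ; positions = λ _ () ; nested = [] }))
       andThen λ u (t≤ , outcome) →
       weaken (run-conclude {order = order} greedy full (λ w → trans (arrs u 0 (toℕ w)) (lists w))
                 (λ k → trans (arrs u 6 k) (empty 6 (λ ()) k)) (trans (regs u 10) order≡) outcome)
         λ _ (ok , t′≤) → ok , time t≤ t′≤)
    where
    greedy : Greedy G (reverse order)
    greedy = proj₁ (search-greedy G dfs tt)
    full : ∀ v → v ∈ reverse order
    full = proj₂ (search-greedy G dfs tt)
    sum≡ : ∀ n m → suc (1 + 20 * (2 * (n + m)) + (17 + 12 * n)) + (53 + 20 * n + 32 * m) ≡ 72 * (1 + n + m)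
    sum≡ = solve-∀
    time : ∀ {t t′} → t ≤ 1 + 20 * weight G (reverse order) → t′ ≤ 17 + 12 * n → suc (t + t′) ≤ 72 * (1 + n + edgeCount)
    time t≤ t′≤ = ℕ.≤-trans (s≤s (ℕ.+-mono-≤
        (ℕ.≤-trans t≤ (s≤s (ℕ.*-monoʳ-≤ 20 (weight-≤ G (greedy⇒unique G (reverse order) greedy) full)))) t′≤))
      (slack (53 + 20 * n + 32 * edgeCount) (sum≡ n edgeCount))

module _ {n} {G : Graph n} (L : AdjacencyLists G) where
  open Graph G

  AnswerWithin : ℕ → ℕ → State → Set
  AnswerWithin c t σ = CorrectAnswer G (reg σ 1) × t ≤ c * (1 + n + edgeCount)

  -- The call costs one step beyond the search itself, which accounts for `suc c`.
  search-then-answer : ∀ c d {order : List (Fin n)} →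
    Run (λ _ _ → ⊥) maxDFS (input L) (λ t σ → reg σ 1 ≡ encode order × t ≤ c * (1 + n + edgeCount)) →
    Run (YieldsAlone L maxDFS) afterSearch (setReg 10 (encode order) (input L)) (AnswerWithin d) →
    ∃[ t ] ∃[ answer ] (YieldsCalling L maxDFS recognize t 1 answer ×
      t ≤ (suc c + d) * (1 + n + edgeCount) × CorrectAnswer G answer)
  search-then-answer c d (run ex (order≡ , s≤)) (run ex′ (ok , t≤)) =
    _ , _ , (_ , seq (search (_ , ex , order≡)) ex′ , refl) ,
    ℕ.≤-trans (ℕ.+-mono-≤ (ℕ.+-mono-≤ (s≤s z≤n) s≤) t≤) (ℕ.≤-reflexive (sym (ℕ.*-distribʳ-+ _ (suc c) d))) , ok

-- The 1 in `YieldsCalling` expresses "once and only once".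
theorem3 : ∃[ maxDFS ] ∃[ recognize ] ∃[ c ]
    (ImplementsMaxDFS maxDFS ×
    (∀ {n} (G : Graph n) (L : AdjacencyLists G) →
    ∃[ t ] ∃[ answer ]
    (YieldsCalling L maxDFS recognize t 1 answer ×
    t ≤ c * (1 + n + Graph.edgeCount G) ×
    CorrectAnswer G answer)))
theorem3 = maxDFS , recognize , suc 62 + 72 , implements , recognizes
  where
  implements : ImplementsMaxDFS maxDFS
  implements G L with run ex (order , order≡ , dfs , _) ← run-maxDFS {λ _ _ → ⊥} L = _ , order , (_ , ex , order≡) , dfs

  recognizes : ∀ {n} (G : Graph n) (L : AdjacencyLists G) → ∃[ t ] ∃[ answer ]
    (YieldsCalling L maxDFS recognize t 1 answer ×
     t ≤ (suc 62 + 72) * (1 + n + Graph.edgeCount G) × CorrectAnswer G answer)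
  recognizes G L = fromSearch (run-maxDFS L)
    where
    fromSearch : Run (λ _ _ → ⊥) maxDFS (input L) _ → _
    fromSearch (run ex (order , order≡ , dfs , s≤)) = search-then-answer L 62 72 {order} (run ex (order≡ , s≤))
      (run-afterSearch L {order = order} dfs (input-lists L)
        (λ { 0 a≢0 → ⊥-elim (a≢0 refl) ; (suc _) _ _ → refl }) refl refl refl)
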